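{- Let $\mathcal{L}$ be a list of extended rules and let $t\in\mathcal{T}(\mathcal{F})$. Then: (1) $t\longrightarrow_{\mathcal{L}}t'$ if and only if $t\longrightarrow_{\mathfrak{T^{ap}}(\mathcal{L})}t'$; (2) $t\longrightarrow_{\mathcal{L}}t'$ if and only if $t\longrightarrow_{\mathfrak{T}(\mathcal{L})}t'$. Here $\mathfrak{T^{ap}}=\mathfrak{T}^{@}\circ\mathfrak{T}^{\setminus}$ (producing a list of rules) and $\mathfrak{T}=\mathfrak{T}^{@}\circ\mathfrak{T}^{<}$ (producing a set of rules).
   Context: Signature. A set $\mathcal{F}$ of symbols with arities is partitioned into defined symbols $\mathcal{D}$ and a finite set $\mathcal{C}$ of constructors; $\mathcal{X}$ is a countable set of variables. $\mathcal{T}(\mathcal{F},\mathcal{X})$, $\mathcal{T}(\mathcal{C},\mathcal{X})$ are the sets of terms, $\mathcal{T}(\mathcal{F})$, $\mathcal{T}(\mathcal{C})$ the ground ones. $\mathcal{P}os(t)$ is the set of positions of $t$, $t_{|\omega}$ the subterm and $t(\omega)$ the symbol at $\omega$, $t[s]_\omega$ replacement. A term is linear if each variable occurs at most once. Constructor patterns are linear terms of $\mathcal{T}(\mathcal{C},\mathcal{X})$ and linear tuples of them; values are elements of $\mathcal{T}(\mathcal{C})$ and tuples of these. Tuples $\langle p_1,\dots,p_n\rangle$ are built with tuple symbols collected in a set $\mathsf{L}$ (one symbol per arity). Extended patterns: $p::=x\in\mathcal{X}\mid c(p_1,\dots,p_n)\mid p_1+p_2\mid p_1\setminus p_2\mid\bot\mid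 q@p$, with $c\in\mathcal{C}$, $q\in\mathcal{T}(\mathcal{C},\mathcal{X})$ ($+,\setminus,\bot,@$ are formal symbols; $@$ binds tighter than $\setminus$, which binds tighter than $+$). All notions extend to tuples: $n$-tuples of extended patterns, and their combinations by $+,\setminus,\bot$, are also called extended patterns. All extended patterns are assumed linear: $p_1+p_2$ is linear if $p_1,p_2$ are; $c(p_1,\dots,p_n)$ (or a tuple) is linear if the $p_i$ are linear with disjoint variables; $p_1\setminus p_2$ and $q@p$ are linear if both arguments are linear with disjoint variables (variables are renamed apart if necessary). Additive: contains no $\setminus$. Pure: contains no $\bot$. Anti-patterns $!p$ are syntactic sugar for $z\setminus p$, $z$ a fresh variable. Ground semantics: $[\![x]\!]=\mathcal{T}(\mathcal{C})$, $[\![c(p_1,\dots,p_n)]\!]=\{c(t_1,\dots,t_n)\mid t_i\in[\![p_i]\!]\}$ (likewise for tuples), $[\![p_1+p_2]\!]=[\![p_1]\!]\cup[\![p_2]\!]$, $[\![p_1\setminus p_2]\!]=[\![p_1]\!]\setminus[\![p_2]\!]$, $[\![\bot]\!]=\emptyset$, $[\![q@p]\!]=[\![q]\!]\cap[\![p]\!]$. Matchable variables: $\mathcal{MV}(x)=\{x\}$; $\mathcal{MV}(f(p_1,\dots,p_n))=\bigcup_i\mathcal{MV}(p_i)$ ($f$ a constructor or tuple symbol); $\mathcal{MV}(p_1+p_2)=\mathcal{MV}(p_1)\cap\mathcal{MV}(p_2)$; $\mathcal{MV}(p_1\setminus p_2)=\mathcal{MV}(p_1)$; $\mathcal{MV}(\bot)=\mathcal{X}$;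 $\mathcal{MV}(q@p)=\mathcal{MV}(q)\cup\mathcal{MV}(p)$. Extended rules. An extended rule is a pair $l\to r$ with $l=\varphi(\vec p)$, $\varphi\in\mathcal{D}$, $\vec p$ a tuple of extended patterns, $r\in\mathcal{T}(\mathcal{F},\mathcal{X})$, $\mathcal{V}ar(r)\subseteq\mathcal{MV}(\vec p)$. Extended rules are assumed to contain no $\bot$, and all aliases in their left-hand sides are of the form $x@p$ with $x\in\mathcal{X}$. A set $\mathcal{E}=\{\varphi(\vec p_1)\to r_1,\dots,\varphi(\vec p_n)\to r_n\}$ induces the relation over $\mathcal{T}(\mathcal{F})$: $t\longrightarrow_{\mathcal{E}}t'$ iff there are $i$, $\omega\in\mathcal{P}os(t)$ and a substitution $\sigma$ with $t_{|\omega}=\varphi(\vec v)$ for a tuple of values $\vec v$, $\mathcal{D}om(\sigma)=\mathcal{MV}(\vec p_i)$, $\vec v\in[\![\sigma(\vec p_i)]\!]$ and $t'=t[\sigma(r_i)]_\omega$. A list $\mathcal{L}=[\varphi(\vec p_1)\to r_1,\dots,\varphi(\vec p_n)\to r_n]$ induces $\longrightarrow_{\mathcal{L}}$ over $\mathcal{T}(\mathcal{F})$ by the same conditions plus: $\vec p_j$ does not match $\vec v$ (i.e. $\vec v\notin[\![\vec p_j]\!]$) for all $j<i$. Rewriting system $\mathfrak{R}^{@}_{\setminus}$ (applied at any position of an extended pattern): here $v,v_i,w,w_i$ range over additive patterns, $t_i$ over pure additive patterns, $V$ over pattern variables; $z_i$ are freshly generated pattern variables; $f,g$ range over all constructors and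 tuple symbols, $h$ over constructors of positive arity and tuple symbols. (A1) $\bot+v\Rightarrow v$; (A2) $v+\bot\Rightarrow v$; (E1) $h(v_1,\dots,\bot,\dots,v_n)\Rightarrow\bot$; (E2) $V@\bot\Rightarrow\bot$; (S1) $h(v_1,\dots,v_i+w_i,\dots,v_n)\Rightarrow h(v_1,\dots,v_i,\dots,v_n)+h(v_1,\dots,w_i,\dots,v_n)$; (S2) $V@(v_1+v_2)\Rightarrow V@v_1+V@v_2$; (M1) $v\setminus V\Rightarrow\bot$; (M2) $v\setminus\bot\Rightarrow v$; (M3) $w\setminus(v_1+v_2)\Rightarrow(w\setminus v_1)\setminus v_2$; (M4') $V\setminus g(t_1,\dots,t_n)\Rightarrow V@\big(\sum_{c\in\mathcal{C}}c(z_1,\dots,z_m)\setminus g(t_1,\dots,t_n)\big)$ with $m$ the arity of $c$ (the complement applies to the whole sum); (M5) $\bot\setminus f(v_1,\dots,v_n)\Rightarrow\bot$; (M6) $(v+w)\setminus f(v_1,\dots,v_n)\Rightarrow(v\setminus f(v_1,\dots,v_n))+(w\setminus f(v_1,\dots,v_n))$; (M7) $f(v_1,\dots,v_n)\setminus f(t_1,\dots,t_n)\Rightarrow f(v_1\setminus t_1,\dots,v_n)+\cdots+f(v_1,\dots,v_n\setminus t_n)$ (for a constant $c$: $c\setminus c\Rightarrow\bot$); (M8) $f(v_1,\dots,v_n)\setminus g(w_1,\dots,w_m)\Rightarrow f(v_1,\dots,v_n)$ if $f\neq g$; (M9) $V@v\setminus w\Rightarrow V@(v\setminus w)$; (M10)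 $v\setminus V@w\Rightarrow v\setminus w$. $p\downarrow_{\mathfrak{R}^{@}_{\setminus}}$ denotes the normal form of $p$; it is either $\bot$ or a sum of (tuples of) constructor patterns potentially aliased. Transformations. For $\mathcal{L}=[\varphi(\vec p_1)\to t_1,\dots,\varphi(\vec p_n)\to t_n]$: $\mathfrak{T}^{\setminus}(\mathcal{L})$ is the concatenation, in the order $i=1,\dots,n$, of the lists $[\varphi(\vec q^{\,i}_1)\to t_i,\dots,\varphi(\vec q^{\,i}_m)\to t_i]$ where $\vec q^{\,i}_1+\cdots+\vec q^{\,i}_m=\vec p_i\downarrow_{\mathfrak{R}^{@}_{\setminus}}\neq\bot$ and no $\vec q^{\,i}_j$ contains $+$ (the list is empty for those $i$ whose normal form is $\bot$; $m$ depends on $i$). $\mathfrak{T}^{<}(\mathcal{L})$ is the union over $i=1,\dots,n$ of the sets $\{\varphi(\vec q^{\,i}_1)\to t_i,\dots,\varphi(\vec q^{\,i}_m)\to t_i\}$ where $\vec q^{\,i}_1+\cdots+\vec q^{\,i}_m=\big(\vec p_i\setminus(\vec p_1+\cdots+\vec p_{i-1})\big)\downarrow_{\mathfrak{R}^{@}_{\setminus}}\neq\bot$ and no $\vec q^{\,i}_j$ contains $+$ (empty set if the normal form is $\bot$; for $i=1$ nothing is subtracted). $\mathfrak{T}^{@}$ removes aliases: $\mathfrak{T}^{@}(\varphi(p)\to r)=\varphi(p)\to r$ if $p$ contains no $@$; $\mathfrak{T}^{@}(\varphi(p[x@q]_\omega)\to r)=\mathfrak{T}^{@}(\varphi(p[q]_\omega)\to\{x\mapsto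 q\}r)$ if $q$ contains no $@$; it is applied elementwise to lists and sets of rules.
   Formalization: The left-to-right direction of (1) additionally assumes that L contracts each φ(v) to at most one result; without this it is false, e.g. for L = [φ(c(x,y)+c(y,x)) → x], where φ(c(a,b)) rewrites to both a and b under L but only to a under the transformed list. -}

module Defs where

open import Data.Bool using (if_then_else_)
open import Data.Empty using (⊥)
open import Data.Fin using (Fin)
import Data.Fin as Fin
open import Data.List using (List; []; _∷_; _++_; [_]; map; tabulate; allFin; length; lookup; _∷ʳ_)
open import Data.List.Membership.Propositional using (_∈_)
open import Data.List.Relation.Binary.Disjoint.Propositional using (Disjoint)
open import Data.List.Relation.Binary.Pointwise using (Pointwise)
open import Data.List.Relation.Unary.All using (All)
open import Data.List.Relation.Unary.Unique.Propositional using (Unique)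
open import Data.Nat using (ℕ; _≟_)
open import Data.Product using (Σ-syntax; ∃; ∃-syntax; _×_; _,_)
open import Data.Sum using (_⊎_; inj₁; inj₂; [_,_]′)
open import Data.Unit using (⊤)
open import Data.Vec as Vec using (Vec; []; _∷_; _[_]≔_)
open import Function using (_∘_; Injective)
open import Relation.Binary.PropositionalEquality using (_≡_; _≢_)
open import Relation.Nullary using (¬_)
open import Relation.Nullary.Decidable using (does)
open import Relation.Unary using (Pred; _∪_; _∩_; _⊆_; _≐_; ∅; U; ｛_｝)
open import Level using (0ℓ)

data Term (F : Set) (ar : F → ℕ) (X : Set) : Set where
  var : X → Term F ar X
  app : (f : F) → Vec (Term F ar X) (ar f) → Term F ar X

module _ {F : Set} {ar : F → ℕ} where

  vars  : ∀ {X} → Term F ar X → List X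
  vars* : ∀ {X n} → Vec (Term F ar X) n → List X
  vars  (var x)    = [ x ]
  vars  (app f ts) = vars* ts
  vars* []         = []
  vars* (t ∷ ts)   = vars t ++ vars* ts

  sub  : ∀ {X Y} → (X → Term F ar Y) → Term F ar X → Term F ar Y
  sub* : ∀ {X Y n} → (X → Term F ar Y) → Vec (Term F ar X) n → Vec (Term F ar Y) n
  sub  σ (var x)    = σ x
  sub  σ (app f ts) = app f (sub* σ ts)
  sub* σ []         = []
  sub* σ (t ∷ ts)   = sub σ t ∷ sub* σ ts

  data Pos {X : Set} : Term F ar X → Set where
    here  : ∀ {t} → Pos t
    below : ∀ {f ts} (i : Fin (ar f)) → Pos (Vec.lookup ts i) → Pos (app f ts)

  infix 6 _∣_
  _∣_ : ∀ {X} (t : Term F ar X) → Pos t → Term F ar X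
  t        ∣ here      = t
  app f ts ∣ below i ω = Vec.lookup ts i ∣ ω

  replace : ∀ {X} (t : Term F ar X) → Pos t → Term F ar X → Term F ar X
  replace t          here        s = s
  replace (app f ts) (below i ω) s = app f (ts [ i ]≔ replace (Vec.lookup ts i) ω s)

-- Only the finiteness of the set of constructors matters, so it is Fin n.
record Signature : Set₁ where
  field
    #constructors : ℕ
    arity-con     : Fin #constructors → ℕ
    Defined       : Set
    arity-def     : Defined → ℕ

Var : Set
Var = ℕ

module Extended (S : Signature) where
  open Signature S public

  Con : Set
  Con = Fin #constructors

  T⟨C⟩ T⟨F⟩ : Set → Set
  T⟨C⟩ = Term Con arity-con
  T⟨F⟩ = Term (Con ⊎ Defined) [ arity-con , arity-def ]′

  GroundTerm : Set
  GroundTerm = T⟨F⟩ ⊥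

  ⌈_⌉  : ∀ {X} → T⟨C⟩ X → T⟨F⟩ X
  ⌈_⌉* : ∀ {X n} → Vec (T⟨C⟩ X) n → Vec (T⟨F⟩ X) n
  ⌈ var x ⌉     = var x
  ⌈ app c ts ⌉  = app (inj₁ c) ⌈ ts ⌉*
  ⌈ [] ⌉*       = []
  ⌈ t ∷ ts ⌉*   = ⌈ t ⌉ ∷ ⌈ ts ⌉*

  ground : GroundTerm → T⟨F⟩ Var
  ground = sub λ ()

  -- Substitutions act on patterns, hence have their range in T(C,X); on
  -- T(F,X) they act through ⌈_⌉.
  Subst : Set
  Subst = Var → T⟨C⟩ Var

  Dom : Subst → Pred Var 0ℓ
  Dom σ x = σ x ≢ var x

  _↦_ : Var → T⟨C⟩ Var → Subst
  (x ↦ q) y = if does (y ≟ x) then q else var y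

  inst : Subst → T⟨F⟩ Var → T⟨F⟩ Var
  inst σ = sub (⌈_⌉ ∘ σ)

  -- The sort separates patterns for terms from patterns for n-tuples of
  -- terms; tuples do not nest.
  data Sort : Set where
    val : Sort
    tup : ℕ → Sort

  data Symbol : Sort → Set where
    con : Con → Symbol val
    tup : ∀ n → Symbol (tup n)

  arity : ∀ {s} → Symbol s → ℕ
  arity (con c) = arity-con c
  arity (tup n) = n

  infixl 6 _⊕_
  infixl 7 _∖_
  infix  8 _at_

  -- q at p is the alias q@p.
  data Pat : Sort → Set where
    var  : Var → Pat val
    node : ∀ {s} (f : Symbol s) → Vec (Pat val) (arity f) → Pat s
    _⊕_  : ∀ {s} → Pat s → Pat s → Pat s
    _∖_  : ∀ {s} → Pat s → Pat s → Pat s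
    bot  : ∀ {s} → Pat s
    _at_ : T⟨C⟩ Var → Pat val → Pat val

  pat  : T⟨C⟩ Var → Pat val
  pat* : ∀ {n} → Vec (T⟨C⟩ Var) n → Vec (Pat val) n
  pat (var x)    = var x
  pat (app c ts) = node (con c) (pat* ts)
  pat* []        = []
  pat* (t ∷ ts)  = pat t ∷ pat* ts

  subP  : ∀ {s} → Subst → Pat s → Pat s
  subP* : ∀ {n} → Subst → Vec (Pat val) n → Vec (Pat val) n
  subP σ (var x)     = pat (σ x)
  subP σ (node f ps) = node f (subP* σ ps)
  subP σ (p ⊕ q)     = subP σ p ⊕ subP σ q
  subP σ (p ∖ q)     = subP σ p ∖ subP σ q
  subP σ bot         = bot
  subP σ (q at p)    = sub σ q at subP σ p
  subP* σ []         = []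
  subP* σ (p ∷ ps)   = subP σ p ∷ subP* σ ps

  ⨁ : ∀ {s} → List (Pat s) → Pat s
  ⨁ []           = bot
  ⨁ (p ∷ [])     = p
  ⨁ (p ∷ q ∷ ps) = p ⊕ ⨁ (q ∷ ps)

  -- All variables, including those to the right of a complement.
  varsP  : ∀ {s} → Pat s → List Var
  varsP* : ∀ {n} → Vec (Pat val) n → List Var
  varsP (var x)     = [ x ]
  varsP (node f ps) = varsP* ps
  varsP (p ⊕ q)     = varsP p ++ varsP q
  varsP (p ∖ q)     = varsP p ++ varsP q
  varsP bot         = []
  varsP (q at p)    = vars q ++ varsP p
  varsP* []         = []
  varsP* (p ∷ ps)   = varsP p ++ varsP* ps

  Linear  : ∀ {s} → Pat s → Set
  Linear* : ∀ {n} → Vec (Pat val) n → Set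
  Linear (var x)     = ⊤
  Linear (node f ps) = Linear* ps
  Linear (p ⊕ q)     = Linear p × Linear q
  Linear (p ∖ q)     = Linear p × Linear q × Disjoint (varsP p) (varsP q)
  Linear bot         = ⊤
  Linear (q at p)    = Unique (vars q) × Linear p × Disjoint (vars q) (varsP p)
  Linear* []         = ⊤
  Linear* (p ∷ ps)   = Linear p × Linear* ps × Disjoint (varsP p) (varsP* ps)

  data Op : Set where
    sum complement bottom alias : Op

  Avoids  : ∀ {s} → Op → Pat s → Set
  Avoids* : ∀ {n} → Op → Vec (Pat val) n → Set
  Avoids o (var x)     = ⊤
  Avoids o (node f ps) = Avoids* o ps
  Avoids o (p ⊕ q)     = o ≢ sum × Avoids o p × Avoids o q
  Avoids o (p ∖ q)     = o ≢ complement × Avoids o p × Avoids o q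
  Avoids o bot         = o ≢ bottom
  Avoids o (q at p)    = o ≢ alias × Avoids o p
  Avoids* o []         = ⊤
  Avoids* o (p ∷ ps)   = Avoids o p × Avoids* o ps

  Additive Pure : ∀ {s} → Pat s → Set
  Additive = Avoids complement
  Pure     = Avoids bottom

  Additive* Pure* : ∀ {n} → Vec (Pat val) n → Set
  Additive* = Avoids* complement
  Pure*     = Avoids* bottom

  VarAliases  : ∀ {s} → Pat s → Set
  VarAliases* : ∀ {n} → Vec (Pat val) n → Set
  VarAliases (var x)     = ⊤
  VarAliases (node f ps) = VarAliases* ps
  VarAliases (p ⊕ q)     = VarAliases p × VarAliases q
  VarAliases (p ∖ q)     = VarAliases p × VarAliases q
  VarAliases bot         = ⊤
  VarAliases (q at p)    = (∃[ x ] q ≡ var x) × VarAliases p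
  VarAliases* []         = ⊤
  VarAliases* (p ∷ ps)   = VarAliases p × VarAliases* ps

  MV  : ∀ {s} → Pat s → Pred Var 0ℓ
  MV* : ∀ {n} → Vec (Pat val) n → Pred Var 0ℓ
  MV (var x)     = ｛ x ｝
  MV (node f ps) = MV* ps
  MV (p ⊕ q)     = MV p ∩ MV q
  MV (p ∖ q)     = MV p
  MV bot         = U
  MV (q at p)    = (_∈ vars q) ∪ MV p
  MV* []         = ∅
  MV* (p ∷ ps)   = MV p ∪ MV* ps

  Val : Sort → Set
  Val val     = T⟨C⟩ ⊥
  Val (tup n) = Vec (T⟨C⟩ ⊥) n

  build : ∀ {s} (f : Symbol s) → Vec (Val val) (arity f) → Val s
  build (con c) vs = app c vs
  build (tup n) vs = vs

  ⟦_⟧ᵗ  : T⟨C⟩ Var → Pred (Val val) 0ℓ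
  ⟦_⟧ᵗ* : ∀ {n} → Vec (T⟨C⟩ Var) n → Pred (Vec (Val val) n) 0ℓ
  ⟦ var x ⟧ᵗ    v = ⊤
  ⟦ app c ts ⟧ᵗ v = ∃[ vs ] v ≡ app c vs × ⟦ ts ⟧ᵗ* vs
  ⟦ [] ⟧ᵗ*     []       = ⊤
  ⟦ t ∷ ts ⟧ᵗ* (v ∷ vs) = ⟦ t ⟧ᵗ v × ⟦ ts ⟧ᵗ* vs

  ⟦_⟧  : ∀ {s} → Pat s → Pred (Val s) 0ℓ
  ⟦_⟧* : ∀ {n} → Vec (Pat val) n → Pred (Vec (Val val) n) 0ℓ
  ⟦ var x ⟧     v = ⊤
  ⟦ node f ps ⟧ v = ∃[ vs ] v ≡ build f vs × ⟦ ps ⟧* vs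
  ⟦ p ⊕ q ⟧     v = ⟦ p ⟧ v ⊎ ⟦ q ⟧ v
  ⟦ p ∖ q ⟧     v = ⟦ p ⟧ v × ¬ ⟦ q ⟧ v
  ⟦ bot ⟧       v = ⊥
  ⟦ q at p ⟧    v = ⟦ q ⟧ᵗ v × ⟦ p ⟧ v
  ⟦ [] ⟧*     []       = ⊤
  ⟦ p ∷ ps ⟧* (v ∷ vs) = ⟦ p ⟧ v × ⟦ ps ⟧* vs

  data Cong (R : ∀ {s} → Pat s → Pat s → Set) : ∀ {s} → Pat s → Pat s → Set where
    root   : ∀ {s} {p p' : Pat s} → R p p' → Cong R p p'
    inNode : ∀ {s} {f : Symbol s} {ps p'} (i : Fin (arity f)) →
             Cong R (Vec.lookup ps i) p' → Cong R (node f ps) (node f (ps [ i ]≔ p'))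
    in⊕ˡ   : ∀ {s} {p p' q : Pat s} → Cong R p p' → Cong R (p ⊕ q) (p' ⊕ q)
    in⊕ʳ   : ∀ {s} {p q q' : Pat s} → Cong R q q' → Cong R (p ⊕ q) (p ⊕ q')
    in∖ˡ   : ∀ {s} {p p' q : Pat s} → Cong R p p' → Cong R (p ∖ q) (p' ∖ q)
    in∖ʳ   : ∀ {s} {p q q' : Pat s} → Cong R q q' → Cong R (p ∖ q) (p ∖ q')
    inAt   : ∀ {q p p'} → Cong R p p' → Cong R (q at p) (q at p')

  allCons : (∀ c → Vec Var (arity-con c)) → Pat val
  allCons zs = ⨁ (map (λ c → node (con c) (Vec.map var (zs c))) (allFin #constructors))

  -- W lists the variables that generated variables must differ from.  In E1
  -- and S1 the index i forces the symbol to have positive arity; for a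
  -- nullary symbol M7 yields ⊥.
  data Rewrite (W : List Var) : ∀ {s} → Pat s → Pat s → Set where
    A1  : ∀ {s} {v : Pat s} → Additive v →
          Rewrite W (bot ⊕ v) v
    A2  : ∀ {s} {v : Pat s} → Additive v →
          Rewrite W (v ⊕ bot) v
    E1  : ∀ {s} {h : Symbol s} {vs} (i : Fin (arity h)) → Additive* vs →
          Vec.lookup vs i ≡ bot →
          Rewrite W (node h vs) bot
    E2  : ∀ {x} →
          Rewrite W (var x at bot) bot
    S1  : ∀ {s} {h : Symbol s} {vs v w} (i : Fin (arity h)) → Additive* vs →
          Vec.lookup vs i ≡ v ⊕ w →
          Rewrite W (node h vs) (node h (vs [ i ]≔ v) ⊕ node h (vs [ i ]≔ w))
    S2  : ∀ {x v w} → Additive v → Additive w →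
          Rewrite W (var x at (v ⊕ w)) (var x at v ⊕ var x at w)
    M1  : ∀ {v x} → Additive v →
          Rewrite W (v ∖ var x) bot
    M2  : ∀ {s} {v : Pat s} → Additive v →
          Rewrite W (v ∖ bot) v
    M3  : ∀ {s} {w v₁ v₂ : Pat s} → Additive w → Additive v₁ → Additive v₂ →
          Rewrite W (w ∖ (v₁ ⊕ v₂)) (w ∖ v₁ ∖ v₂)
    M4' : ∀ {x} {g : Symbol val} {ts} → Pure* ts → Additive* ts →
          (zs : ∀ c → Vec Var (arity-con c)) →
          (∀ c → Unique (Vec.toList (zs c))) →
          (∀ c → Disjoint W (Vec.toList (zs c))) →
          Rewrite W (var x ∖ node g ts) (var x at (allCons zs ∖ node g ts))
    M5  : ∀ {s} {f : Symbol s} {vs} → Additive* vs →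
          Rewrite W (bot ∖ node f vs) bot
    M6  : ∀ {s} {v w : Pat s} {f : Symbol s} {vs} →
          Additive v → Additive w → Additive* vs →
          Rewrite W ((v ⊕ w) ∖ node f vs) (v ∖ node f vs ⊕ w ∖ node f vs)
    M7  : ∀ {s} {f : Symbol s} {vs ts} → Additive* vs → Pure* ts → Additive* ts →
          Rewrite W (node f vs ∖ node f ts)
                    (⨁ (tabulate λ i →
                      node f (vs [ i ]≔ (Vec.lookup vs i ∖ Vec.lookup ts i))))
    M8  : ∀ {s} {f g : Symbol s} {vs ws} → f ≢ g → Additive* vs → Additive* ws →
          Rewrite W (node f vs ∖ node g ws) (node f vs)
    M9  : ∀ {x v w} → Additive v → Additive w →
          Rewrite W (var x at v ∖ w) (var x at (v ∖ w))
    M10 : ∀ {v x w} → Additive v → Additive w →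
          Rewrite W (v ∖ var x at w) (v ∖ w)

  infix 4 _⊢_⇒_ _⊢_⇓_ _↓_
  _⊢_⇒_ : ∀ {s} → List Var → Pat s → Pat s → Set
  W ⊢ p ⇒ q = Cong (Rewrite W) p q

  Normal : ∀ {s} → Pat s → Set
  Normal p = ∀ {W q} → ¬ (W ⊢ p ⇒ q)

  -- W accumulates every variable that has occurred so far.
  data _⊢_⇓_ {s} (W : List Var) : Pat s → Pat s → Set where
    stop : ∀ {p} → Normal p → W ⊢ p ⇓ p
    step : ∀ {p p' q} → W ⊢ p ⇒ p' → (varsP p' ++ W) ⊢ p' ⇓ q → W ⊢ p ⇓ q

  -- q is a normal form of p.  Normal forms are determined only up to the
  -- choice of the generated variables, so this is a relation.
  _↓_ : ∀ {s} → Pat s → Pat s → Set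
  p ↓ q = varsP p ⊢ p ⇓ q

module Rules (S : Signature) (φ : Signature.Defined S) where
  open Extended S public

  infix 3 _⟶_
  record Rule : Set where
    constructor _⟶_
    field
      lhs : Pat (tup (arity-def φ))
      rhs : T⟨F⟩ Var
  open Rule public

  record ExtendedRule (ρ : Rule) : Set where
    field
      linear     : Linear (lhs ρ)
      vars⊆      : (_∈ vars (rhs ρ)) ⊆ MV (lhs ρ)
      pure       : Pure (lhs ρ)
      varAliases : VarAliases (lhs ρ)

  Args : Set
  Args = Val (tup (arity-def φ))

  redex : Args → GroundTerm
  redex vs = app (inj₂ φ) ⌈ vs ⌉*

  Contracts : Rule → Args → GroundTerm → Set
  Contracts ρ vs u =
    Σ[ σ ∈ Subst ] Dom σ ≐ MV (lhs ρ)
                 × ⟦ subP σ (lhs ρ) ⟧ vs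
                 × ground u ≡ inst σ (rhs ρ)

  SetContracts : Pred Rule 0ℓ → Args → GroundTerm → Set
  SetContracts E vs u = ∃[ ρ ] E ρ × Contracts ρ vs u

  ListContracts : List Rule → Args → GroundTerm → Set
  ListContracts L vs u =
    Σ[ i ∈ Fin (length L) ] (∀ j → j Fin.< i → ¬ ⟦ lhs (lookup L j) ⟧ vs)
                          × Contracts (lookup L i) vs u

  Step : (Args → GroundTerm → Set) → GroundTerm → GroundTerm → Set
  Step R t t' = Σ[ ω ∈ Pos t ] ∃[ vs ] ∃[ u ]
                t ∣ ω ≡ redex vs × R vs u × t' ≡ replace t ω u

  infix 4 _⟶⟨_⟩_ _⟶[_]_
  _⟶⟨_⟩_ : GroundTerm → Pred Rule 0ℓ → GroundTerm → Set
  t ⟶⟨ E ⟩ t' = Step (SetContracts E) t t'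

  _⟶[_]_ : GroundTerm → List Rule → GroundTerm → Set
  t ⟶[ L ] t' = Step (ListContracts L) t t'

  -- A value may match p₁ + p₂ in both summands with different bindings of
  -- the shared variables: φ(c(x,y) + c(y,x)) → x contracts φ(c(a,b)) to
  -- both a and b, while [φ(c(x,y)) → x, φ(c(y,x)) → x] only yields a.  A list
  -- obtained by 𝔗ap contracts each φ(vs) in at most one way.
  Unambiguous : List Rule → Set
  Unambiguous L = ∀ {vs u u'} →
    ListContracts L vs u → ListContracts L vs u' → u ≡ u'

  summands : ∀ {s} → Pat s → List (Pat s)
  summands (p ⊕ q) = summands p ++ summands q
  summands bot     = []
  summands p       = [ p ]

  -- The rules φ(q₁) → r, …, φ(qₘ) → r with q₁ + ⋯ + qₘ = p↓
  data Split (p : Pat (tup (arity-def φ))) (r : T⟨F⟩ Var) : List Rule → Set where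
    split : ∀ {q} → p ↓ q → All (Avoids sum) (summands q) →
            Split p r (map (_⟶ r) (summands q))

  data 𝔗∖ : List Rule → List Rule → Set where
    []  : 𝔗∖ [] []
    _∷_ : ∀ {p r Q L M} → Split p r Q → 𝔗∖ L M → 𝔗∖ ((p ⟶ r) ∷ L) (Q ++ M)

  Variant : ∀ {s} → Pat s → Pat s → Set
  Variant p p' =
    Σ[ α ∈ (Var → Var) ] Injective _≡_ _≡_ α × p' ≡ subP (var ∘ α) p

  -- p ∖ (p₁ + ⋯ + pₖ), the pᵢ being renamed apart from p
  data Minus {s} (p : Pat s) : List (Pat s) → Pat s → Set where
    nothing : Minus p [] p
    some    : ∀ {p₁ ps p₁' ps'} →
              Pointwise Variant (p₁ ∷ ps) (p₁' ∷ ps') →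
              All (λ q → Disjoint (varsP p) (varsP q)) (p₁' ∷ ps') →
              Minus p (p₁ ∷ ps) (p ∖ ⨁ (p₁' ∷ ps'))

  -- The first list holds the left-hand sides of the preceding rules.
  data 𝔗<-after : List (Pat (tup (arity-def φ))) → List Rule → List Rule → Set where
    []  : ∀ {ps} → 𝔗<-after ps [] []
    _∷_ : ∀ {ps p d r Q L M} →
          Minus p ps d × Split d r Q → 𝔗<-after (ps ∷ʳ p) L M →
          𝔗<-after ps ((p ⟶ r) ∷ L) (Q ++ M)

  𝔗< : List Rule → List Rule → Set
  𝔗< = 𝔗<-after []

  -- Innermost aliases only: q lies in T(C,X), hence contains no @.
  data Unalias (x : Var) (q : T⟨C⟩ Var) : ∀ {s} → Pat s → Pat s → Set where
    unalias : ∀ {p} → p ≡ pat q → Unalias x q (var x at p) p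

  data 𝔗at-rule : Rule → Rule → Set where
    stop : ∀ {p r} → Avoids alias p → 𝔗at-rule (p ⟶ r) (p ⟶ r)
    step : ∀ {p p' r ρ x q} → Cong (Unalias x q) p p' →
           𝔗at-rule (p' ⟶ inst (x ↦ q) r) ρ → 𝔗at-rule (p ⟶ r) ρ

  𝔗at : List Rule → List Rule → Set
  𝔗at = Pointwise 𝔗at-rule

  𝔗ap 𝔗 : List Rule → List Rule → Set
  𝔗ap L M = ∃[ L' ] 𝔗∖ L L' × 𝔗at L' M
  𝔗   L M = ∃[ L' ] 𝔗< L L' × 𝔗at L' M

module Submission where

-- A valuation ρ prescribes the admissible values of each variable; matching
-- under ρ leaves the variables to the right of a complement unconstrained.  For
-- a linear pattern p, the values of σ(p) are those matching p under x ↦ ⟦σ(x)⟧.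
-- Each rewrite rule preserves matching under every ρ that leaves the generated
-- variables free, preserves linearity of the variables outside complements,
-- and never shrinks MV.  A normal form is ⊥ or a sum of patterns without +, ∖
-- and ⊥, and a value matching a linear one q of these, say under σ, determines
-- the values θ of all variables of q, where θ agrees with σ on the right-hand
-- side because the contractum is ground.  Restricting θ to MV(p) gives a
-- contraction by the original rule, and since an alias x@q forces θ(x) = θ(q),
-- removing it does not change the contracta.
--
-- If a value may contract in several ways by a rule, the list obtained by 𝔗∖ only
-- keeps those of the first summand that matches; unambiguity makes them equal.

open import Defs
open import Data.Bool using (if_then_else_)
open import Data.Empty using (⊥; ⊥-elim)
open import Data.Fin using (Fin; zero; suc)
import Data.Fin as Fin
open import Data.Fin.Properties using (toℕ-injective)
open import Data.List using (List; []; _∷_; _++_; map; tabulate; allFin)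
import Data.List.Membership.DecPropositional as DecMembership
open import Data.List.Membership.Propositional using (_∈_; _∉_; find; lose)
open import Data.List.Membership.Propositional.Properties
  using (∈-++⁺ˡ; ∈-++⁺ʳ; ∈-++⁻; ∈-allFin)
open import Data.List.Relation.Binary.Pointwise using (Pointwise; []; _∷_)
open import Data.List.Relation.Unary.All as All using (All; []; _∷_)
import Data.List.Relation.Unary.All.Properties as All
open import Data.List.Relation.Unary.AllPairs using (_∷_)
open import Data.List.Relation.Unary.Any as Any using (Any; here; there)
import Data.List.Relation.Unary.Any.Properties as Any
open import Data.List.Relation.Unary.Unique.Propositional using (Unique)
import Data.List.Relation.Unary.Unique.Propositional.Properties as Unique
open import Data.Nat using (ℕ; _≟_; s≤s; z≤n)
open import Data.Product using (∃-syntax; _×_; _,_; proj₁; proj₂)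
open import Data.Sum as Sum using (_⊎_; inj₁; inj₂)
open import Data.Unit using (⊤; tt)
open import Data.Vec as Vec using (Vec; []; _∷_; _[_]≔_)
open import Function using (_⇔_; _∘_; id; mk⇔)
open import Level using (0ℓ)
open import Relation.Binary.PropositionalEquality
  using (_≡_; _≢_; refl; sym; trans; cong; cong₂; subst)
open import Relation.Nullary using (¬_; Dec; yes; no; contradiction)
open import Relation.Nullary.Decidable
  using (does; _×-dec_; _⊎-dec_; map′; dec-true; dec-false; ¬?)
open import Relation.Unary
  using (Pred; Decidable; _∪_; _∩_; _⊆_; _⊆′_; _≐_; _≐′_; _⊥′_; ∁; ∅; U; ｛_｝)
open import Relation.Unary.Properties using (≐′-refl; ≐′-sym; ≐′-trans)

-- Substitutions themselves are not stable along a reduction: the domain of σ must be exactly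
-- `MV p`, while rewriting can enlarge `MV`. Once a summand has become ⊥, a variable need no longer
-- occur in it to be matchable, and M4' can make generated variables matchable. A valuation has no
-- domain and is consulted only at variables that occur, so the same ρ serves for the whole
-- reduction and the domain condition matters only at its two ends. Leaving the right arguments of
-- complements unconstrained makes M1 and M10 sound for every ρ. It agrees with the semantics of
-- σ(p) because linearity keeps the variables under a complement out of `MV p`, hence out of the
-- domain of σ. Lists and sets differ in what must be tracked. In a set all matching summands can
-- act, so contracta correspond exactly. In a list a rule also acts by blocking its successors, so
-- plain matching has to be preserved as well and has to be decidable.

module _ {F : Set} {ar : F → ℕ} where

  -- Substitution and variables in first-order terms

  sub-cong  : ∀ {X Y} {σ τ : X → Term F ar Y} t →
              (∀ x → x ∈ vars t → σ x ≡ τ x) → sub σ t ≡ sub τ t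
  sub-cong* : ∀ {X Y n} {σ τ : X → Term F ar Y} (ts : Vec _ n) →
              (∀ x → x ∈ vars* ts → σ x ≡ τ x) → sub* σ ts ≡ sub* τ ts
  sub-cong (var x)    eq = eq x (here refl)
  sub-cong (app f ts) eq = cong (app f) (sub-cong* ts eq)
  sub-cong* []       eq = refl
  sub-cong* (t ∷ ts) eq =
    cong₂ _∷_ (sub-cong t λ x x∈ → eq x (∈-++⁺ˡ x∈))
              (sub-cong* ts λ x x∈ → eq x (∈-++⁺ʳ (vars t) x∈))

  sub-sub  : ∀ {X Y Z} (σ : Y → Term F ar Z) (τ : X → Term F ar Y) t →
             sub σ (sub τ t) ≡ sub (sub σ ∘ τ) t
  sub-sub* : ∀ {X Y Z n} (σ : Y → Term F ar Z) (τ : X → Term F ar Y) (ts : Vec _ n) →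
             sub* σ (sub* τ ts) ≡ sub* (sub σ ∘ τ) ts
  sub-sub σ τ (var x)    = refl
  sub-sub σ τ (app f ts) = cong (app f) (sub-sub* σ τ ts)
  sub-sub* σ τ []       = refl
  sub-sub* σ τ (t ∷ ts) = cong₂ _∷_ (sub-sub σ τ t) (sub-sub* σ τ ts)

  sub-var  : ∀ {X} (t : Term F ar X) → sub var t ≡ t
  sub-var* : ∀ {X n} (ts : Vec (Term F ar X) n) → sub* var ts ≡ ts
  sub-var (var x)    = refl
  sub-var (app f ts) = cong (app f) (sub-var* ts)
  sub-var* []       = refl
  sub-var* (t ∷ ts) = cong₂ _∷_ (sub-var t) (sub-var* ts)

  vars-sub⁺  : ∀ {X Y} {σ : X → Term F ar Y} {x y} t →
               x ∈ vars t → y ∈ vars (σ x) → y ∈ vars (sub σ t)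
  vars-sub⁺* : ∀ {X Y n} {σ : X → Term F ar Y} {x y} (ts : Vec _ n) →
               x ∈ vars* ts → y ∈ vars (σ x) → y ∈ vars* (sub* σ ts)
  vars-sub⁺ (var x)    (here refl) y∈ = y∈
  vars-sub⁺ (app f ts) x∈          y∈ = vars-sub⁺* ts x∈ y∈
  vars-sub⁺* {σ = σ} (t ∷ ts) x∈ y∈ with ∈-++⁻ (vars t) x∈
  ... | inj₁ x∈t  = ∈-++⁺ˡ (vars-sub⁺ t x∈t y∈)
  ... | inj₂ x∈ts = ∈-++⁺ʳ (vars (sub σ t)) (vars-sub⁺* ts x∈ts y∈)

  vars-sub⁻  : ∀ {X Y} {σ : X → Term F ar Y} {y} t →
               y ∈ vars (sub σ t) → ∃[ x ] x ∈ vars t × y ∈ vars (σ x)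
  vars-sub⁻* : ∀ {X Y n} {σ : X → Term F ar Y} {y} (ts : Vec _ n) →
               y ∈ vars* (sub* σ ts) → ∃[ x ] x ∈ vars* ts × y ∈ vars (σ x)
  vars-sub⁻ (var x)    y∈ = x , here refl , y∈
  vars-sub⁻ (app f ts) y∈ = vars-sub⁻* ts y∈
  vars-sub⁻* {σ = σ} (t ∷ ts) y∈ with ∈-++⁻ (vars (sub σ t)) y∈
  ... | inj₁ y∈t  = let x , x∈ , y∈x = vars-sub⁻ t y∈t in x , ∈-++⁺ˡ x∈ , y∈x
  ... | inj₂ y∈ts = let x , x∈ , y∈x = vars-sub⁻* ts y∈ts in x , ∈-++⁺ʳ (vars t) x∈ , y∈x

  -- The map ι is arbitrary since distinct absurd functions are not
  -- definitionally equal.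
  closed⇒ground  : ∀ {X} {ι : ⊥ → Term F ar X} t →
                   (∀ y → y ∉ vars t) → ∃[ w ] sub ι w ≡ t
  closed⇒ground* : ∀ {X n} {ι : ⊥ → Term F ar X} (ts : Vec _ n) →
                   (∀ y → y ∉ vars* ts) → ∃[ ws ] sub* ι ws ≡ ts
  closed⇒ground (var x)    closed = contradiction (here refl) (closed x)
  closed⇒ground (app f ts) closed =
    let ws , eq = closed⇒ground* ts closed in app f ws , cong (app f) eq
  closed⇒ground* []       closed = [] , refl
  closed⇒ground* (t ∷ ts) closed =
    let w  , eq  = closed⇒ground t λ y y∈ → closed y (∈-++⁺ˡ y∈)
        ws , eqs = closed⇒ground* ts λ y y∈ → closed y (∈-++⁺ʳ (vars t) y∈)
    in w ∷ ws , cong₂ _∷_ eq eqs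

  ground⇒closed : ∀ {X} {ι : ⊥ → Term F ar X} w y → y ∉ vars (sub ι w)
  ground⇒closed w y y∈ with vars-sub⁻ w y∈
  ... | () , _

-- Ground instances and the semantics of patterns

module Semantics (S : Signature) where
  open Extended S

  gr : Val val → T⟨C⟩ Var
  gr = sub λ ()

  vars-⌈⌉⁺  : ∀ {X y} (t : T⟨C⟩ X) → y ∈ vars t → y ∈ vars ⌈ t ⌉
  vars-⌈⌉⁺* : ∀ {X n y} (ts : Vec (T⟨C⟩ X) n) → y ∈ vars* ts → y ∈ vars* ⌈ ts ⌉*
  vars-⌈⌉⁺ (var x)    y∈ = y∈
  vars-⌈⌉⁺ (app c ts) y∈ = vars-⌈⌉⁺* ts y∈
  vars-⌈⌉⁺* (t ∷ ts) y∈ with ∈-++⁻ (vars t) y∈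
  ... | inj₁ y∈t  = ∈-++⁺ˡ (vars-⌈⌉⁺ t y∈t)
  ... | inj₂ y∈ts = ∈-++⁺ʳ (vars ⌈ t ⌉) (vars-⌈⌉⁺* ts y∈ts)

  vars-⌈⌉⁻  : ∀ {X y} (t : T⟨C⟩ X) → y ∈ vars ⌈ t ⌉ → y ∈ vars t
  vars-⌈⌉⁻* : ∀ {X n y} (ts : Vec (T⟨C⟩ X) n) → y ∈ vars* ⌈ ts ⌉* → y ∈ vars* ts
  vars-⌈⌉⁻ (var x)    y∈ = y∈
  vars-⌈⌉⁻ (app c ts) y∈ = vars-⌈⌉⁻* ts y∈
  vars-⌈⌉⁻* (t ∷ ts) y∈ with ∈-++⁻ (vars ⌈ t ⌉) y∈
  ... | inj₁ y∈t  = ∈-++⁺ˡ (vars-⌈⌉⁻ t y∈t)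
  ... | inj₂ y∈ts = ∈-++⁺ʳ (vars t) (vars-⌈⌉⁻* ts y∈ts)

  ⌈⌉-sub  : ∀ {X Y} (σ : X → T⟨C⟩ Y) t → ⌈ sub σ t ⌉ ≡ sub (⌈_⌉ ∘ σ) ⌈ t ⌉
  ⌈⌉-sub* : ∀ {X Y n} (σ : X → T⟨C⟩ Y) (ts : Vec _ n) → ⌈ sub* σ ts ⌉* ≡ sub* (⌈_⌉ ∘ σ) ⌈ ts ⌉*
  ⌈⌉-sub σ (var x)    = refl
  ⌈⌉-sub σ (app c ts) = cong (app _) (⌈⌉-sub* σ ts)
  ⌈⌉-sub* σ []       = refl
  ⌈⌉-sub* σ (t ∷ ts) = cong₂ _∷_ (⌈⌉-sub σ t) (⌈⌉-sub* σ ts)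

  inst-cong : ∀ {σ τ} r → (∀ x → x ∈ vars r → σ x ≡ τ x) → inst σ r ≡ inst τ r
  inst-cong r eq = sub-cong r λ x x∈ → cong ⌈_⌉ (eq x x∈)

  inst-inst : ∀ σ τ r → inst σ (inst τ r) ≡ inst (sub σ ∘ τ) r
  inst-inst σ τ r = trans (sub-sub _ _ r) (sub-cong r λ x _ → sym (⌈⌉-sub σ (τ x)))

  -- A variable left in σ x would survive in `inst σ r`, which is ground.
  ground-inst⁻ : ∀ {σ x} u r → ground u ≡ inst σ r → x ∈ vars r → ∃[ w ] σ x ≡ gr w
  ground-inst⁻ {σ} {x} u r eq x∈ =
    let w , eq′ = closed⇒ground (σ x) λ y y∈ →
          ground⇒closed u y (subst (λ t → y ∈ vars t) (sym eq)
            (vars-sub⁺ r x∈ (vars-⌈⌉⁺ (σ x) y∈)))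
    in w , sym eq′

  ground-inst⁺ : ∀ {σ} r → (∀ x → x ∈ vars r → ∃[ w ] σ x ≡ gr w) →
                 ∃[ u ] ground u ≡ inst σ r
  ground-inst⁺ {σ} r isGround = closed⇒ground (inst σ r) λ y y∈ →
    let x , x∈ , y∈x = vars-sub⁻ r y∈
        w , eq = isGround x x∈
    in ground⇒closed w y (subst (λ t → y ∈ vars t) eq (vars-⌈⌉⁻ (σ x) y∈x))

  ⟦gr⟧  : ∀ w → ⟦ gr w ⟧ᵗ w
  ⟦gr⟧* : ∀ {n} (ws : Vec (Val val) n) → ⟦ sub* (λ ()) ws ⟧ᵗ* ws
  ⟦gr⟧ (app c ws) = ws , refl , ⟦gr⟧* ws
  ⟦gr⟧* []       = tt
  ⟦gr⟧* (w ∷ ws) = ⟦gr⟧ w , ⟦gr⟧* ws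

  ⟦gr⟧⁻  : ∀ w {v} → ⟦ gr w ⟧ᵗ v → v ≡ w
  ⟦gr⟧⁻* : ∀ {n} (ws : Vec (Val val) n) {vs} → ⟦ sub* (λ ()) ws ⟧ᵗ* vs → vs ≡ ws
  ⟦gr⟧⁻ (app c ws) (_ , refl , m) = cong (app c) (⟦gr⟧⁻* ws m)
  ⟦gr⟧⁻* []       {[]}    _        = refl
  ⟦gr⟧⁻* (w ∷ ws) {_ ∷ _} (m , ms) = cong₂ _∷_ (⟦gr⟧⁻ w m) (⟦gr⟧⁻* ws ms)

  gr≢var : ∀ {w x} → gr w ≢ var x
  gr≢var {app _ _} ()

  var-or-not : ∀ (t : T⟨C⟩ Var) x → Dec (t ≡ var x)
  var-or-not (var y)   x = map′ (cong var) (λ { refl → refl }) (y ≟ x)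
  var-or-not (app _ _) x = no λ ()

  -- Written with `does` so that `x ↦ q` is by computation the instance
  -- `choose (_≟ x) (λ _ → q) var`.
  choose : ∀ {P : Pred Var 0ℓ} → Decidable P → Subst → Subst → Subst
  choose P? σ τ x = if does (P? x) then σ x else τ x

  choose-∈ : ∀ {P : Pred Var 0ℓ} (P? : Decidable P) σ τ {x} → P x → choose P? σ τ x ≡ σ x
  choose-∈ P? σ τ {x} Px = cong (if_then σ x else τ x) (dec-true (P? x) Px)

  choose-∉ : ∀ {P : Pred Var 0ℓ} (P? : Decidable P) σ τ {x} → ¬ P x → choose P? σ τ x ≡ τ x
  choose-∉ P? σ τ {x} ¬Px = cong (if_then σ x else τ x) (dec-false (P? x) ¬Px)

  build-injective : ∀ {s} (f : Symbol s) {vs ws} → build f vs ≡ build f ws → vs ≡ ws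
  build-injective (con c) refl = refl
  build-injective (tup n) refl = refl

  build-symbol : ∀ {s} (f g : Symbol s) {vs ws} → build f vs ≡ build g ws → f ≡ g
  build-symbol (con c) (con _) refl = refl
  build-symbol (tup n) (tup _) _    = refl

  unbuild : ∀ (v : Val val) → ∃[ c ] ∃[ vs ] v ≡ build (con c) vs
  unbuild (app c vs) = c , vs , refl

  symbol≟ : ∀ {s} (f g : Symbol s) → Dec (f ≡ g)
  symbol≟ (con c) (con d) = map′ (cong con) (λ { refl → refl }) (c Fin.≟ d)
  symbol≟ (tup n) (tup _) = yes refl

  -- Valuations, matching and occurrences of variables

  Valuation : Set₁
  Valuation = Var → Pred (Val val) 0ℓ

  free : Valuation
  free _ _ = ⊤

  exact : Subst → Valuation
  exact θ x w = θ x ≡ gr w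

  within : Subst → Valuation
  within σ x = ⟦ σ x ⟧ᵗ

  -- In a linear pattern no matchable variable occurs in the right argument of
  -- a complement, hence free there.  The app case is junk: aliases are x@p.
  Sat  : ∀ {s} → Valuation → Pat s → Pred (Val s) 0ℓ
  Sat* : ∀ {n} → Valuation → Vec (Pat val) n → Pred (Vec (Val val) n) 0ℓ
  Sat ρ (var x)         v = ρ x v
  Sat ρ (node f ps)     v = ∃[ vs ] v ≡ build f vs × Sat* ρ ps vs
  Sat ρ (p ⊕ q)         v = Sat ρ p v ⊎ Sat ρ q v
  Sat ρ (p ∖ q)         v = Sat ρ p v × ¬ Sat free q v
  Sat ρ bot             v = ⊥
  Sat ρ (var x at p)    v = ρ x v × Sat ρ p v
  Sat ρ (app _ _ at p)  v = ⊥
  Sat* ρ []       []       = ⊤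
  Sat* ρ (p ∷ ps) (v ∷ vs) = Sat ρ p v × Sat* ρ ps vs

  -- In contrast to `MV`, a sum gives a union and `bot` gives nothing: linearity concerns every
  -- occurrence outside complements, matchability only the bindings common to all summands.
  PosV  : ∀ {s} → Pat s → Pred Var 0ℓ
  PosV* : ∀ {n} → Vec (Pat val) n → Pred Var 0ℓ
  PosV (var x)     = ｛ x ｝
  PosV (node f ps) = PosV* ps
  PosV (p ⊕ q)     = PosV p ∪ PosV q
  PosV (p ∖ q)     = PosV p
  PosV bot         = ∅
  PosV (q at p)    = (_∈ vars q) ∪ PosV p
  PosV* []         = ∅
  PosV* (p ∷ ps)   = PosV p ∪ PosV* ps

  NegV  : ∀ {s} → Pat s → Pred Var 0ℓ
  NegV* : ∀ {n} → Vec (Pat val) n → Pred Var 0ℓ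
  NegV (var x)     = ∅
  NegV (node f ps) = NegV* ps
  NegV (p ⊕ q)     = NegV p ∪ NegV q
  NegV (p ∖ q)     = NegV p ∪ (_∈ varsP q)
  NegV bot         = ∅
  NegV (q at p)    = NegV p
  NegV* []         = ∅
  NegV* (p ∷ ps)   = NegV p ∪ NegV* ps

  -- Unlike Linear, this is preserved by rewriting: M3 makes the summands of a
  -- complement, which may share variables, complements of a common pattern.
  PosLinear  : ∀ {s} → Pat s → Set
  PosLinear* : ∀ {n} → Vec (Pat val) n → Set
  PosLinear (var x)     = ⊤
  PosLinear (node f ps) = PosLinear* ps
  PosLinear (p ⊕ q)     = PosLinear p × PosLinear q
  PosLinear (p ∖ q)     = PosLinear p
  PosLinear bot         = ⊤
  PosLinear (q at p)    = PosLinear p × (_∈ vars q) ⊥′ PosV p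
  PosLinear* []         = ⊤
  PosLinear* (p ∷ ps)   = PosLinear p × PosLinear* ps × PosV p ⊥′ PosV* ps

  Basic  : ∀ {s} → Pat s → Set
  Basic* : ∀ {n} → Vec (Pat val) n → Set
  Basic (var x)        = ⊤
  Basic (node f ps)    = Basic* ps
  Basic (p ⊕ q)        = ⊥
  Basic (p ∖ q)        = ⊥
  Basic bot            = ⊥
  Basic (var x at p)   = Basic p
  Basic (app _ _ at p) = ⊥
  Basic* []            = ⊤
  Basic* (p ∷ ps)      = Basic p × Basic* ps

  _∈?_ : ∀ x (xs : List Var) → Dec (x ∈ xs)
  _∈?_ = DecMembership._∈?_ _≟_

  PosV?  : ∀ {s} (p : Pat s) → Decidable (PosV p)
  PosV?* : ∀ {n} (ps : Vec (Pat val) n) → Decidable (PosV* ps)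
  PosV? (var y)     x = y ≟ x
  PosV? (node f ps) x = PosV?* ps x
  PosV? (p ⊕ q)     x = PosV? p x ⊎-dec PosV? q x
  PosV? (p ∖ q)     x = PosV? p x
  PosV? bot         x = no λ ()
  PosV? (q at p)    x = (x ∈? vars q) ⊎-dec PosV? p x
  PosV?* []         x = no λ ()
  PosV?* (p ∷ ps)   x = PosV? p x ⊎-dec PosV?* ps x

  MV?  : ∀ {s} (p : Pat s) → Decidable (MV p)
  MV?* : ∀ {n} (ps : Vec (Pat val) n) → Decidable (MV* ps)
  MV? (var y)     x = y ≟ x
  MV? (node f ps) x = MV?* ps x
  MV? (p ⊕ q)     x = MV? p x ×-dec MV? q x
  MV? (p ∖ q)     x = MV? p x
  MV? bot         x = yes tt
  MV? (q at p)    x = (x ∈? vars q) ⊎-dec MV? p x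
  MV?* []         x = no λ ()
  MV?* (p ∷ ps)   x = MV? p x ⊎-dec MV?* ps x

  PosV⊆varsP  : ∀ {s} (p : Pat s) → PosV p ⊆′ (_∈ varsP p)
  PosV⊆varsP* : ∀ {n} (ps : Vec (Pat val) n) → PosV* ps ⊆′ (_∈ varsP* ps)
  PosV⊆varsP (var x)     _ refl     = here refl
  PosV⊆varsP (node f ps) x i        = PosV⊆varsP* ps x i
  PosV⊆varsP (p ⊕ q)     x (inj₁ i) = ∈-++⁺ˡ (PosV⊆varsP p x i)
  PosV⊆varsP (p ⊕ q)     x (inj₂ i) = ∈-++⁺ʳ (varsP p) (PosV⊆varsP q x i)
  PosV⊆varsP (p ∖ q)     x i        = ∈-++⁺ˡ (PosV⊆varsP p x i)
  PosV⊆varsP (q at p)    x (inj₁ i) = ∈-++⁺ˡ i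
  PosV⊆varsP (q at p)    x (inj₂ i) = ∈-++⁺ʳ (vars q) (PosV⊆varsP p x i)
  PosV⊆varsP* (p ∷ ps)   x (inj₁ i) = ∈-++⁺ˡ (PosV⊆varsP p x i)
  PosV⊆varsP* (p ∷ ps)   x (inj₂ i) = ∈-++⁺ʳ (varsP p) (PosV⊆varsP* ps x i)

  NegV⊆varsP  : ∀ {s} (p : Pat s) → NegV p ⊆′ (_∈ varsP p)
  NegV⊆varsP* : ∀ {n} (ps : Vec (Pat val) n) → NegV* ps ⊆′ (_∈ varsP* ps)
  NegV⊆varsP (node f ps) x i        = NegV⊆varsP* ps x i
  NegV⊆varsP (p ⊕ q)     x (inj₁ i) = ∈-++⁺ˡ (NegV⊆varsP p x i)
  NegV⊆varsP (p ⊕ q)     x (inj₂ i) = ∈-++⁺ʳ (varsP p) (NegV⊆varsP q x i)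
  NegV⊆varsP (p ∖ q)     x (inj₁ i) = ∈-++⁺ˡ (NegV⊆varsP p x i)
  NegV⊆varsP (p ∖ q)     x (inj₂ i) = ∈-++⁺ʳ (varsP p) i
  NegV⊆varsP (q at p)    x i        = ∈-++⁺ʳ (vars q) (NegV⊆varsP p x i)
  NegV⊆varsP* (p ∷ ps)   x (inj₁ i) = ∈-++⁺ˡ (NegV⊆varsP p x i)
  NegV⊆varsP* (p ∷ ps)   x (inj₂ i) = ∈-++⁺ʳ (varsP p) (NegV⊆varsP* ps x i)

  MV⊆PosV  : ∀ {s} (p : Pat s) → Pure p → MV p ⊆′ PosV p
  MV⊆PosV* : ∀ {n} (ps : Vec (Pat val) n) → Pure* ps → MV* ps ⊆′ PosV* ps
  MV⊆PosV (var x)     _             y i        = i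
  MV⊆PosV (node f ps) pure          y i        = MV⊆PosV* ps pure y i
  MV⊆PosV (p ⊕ q)     (_ , pure , _) y (i , _) = inj₁ (MV⊆PosV p pure y i)
  MV⊆PosV (p ∖ q)     (_ , pure , _) y i       = MV⊆PosV p pure y i
  MV⊆PosV bot         pure          y i        = contradiction refl pure
  MV⊆PosV (q at p)    (_ , pure)    y i        = Sum.map₂ (MV⊆PosV p pure y) i
  MV⊆PosV* (p ∷ ps)   (pure , pures) y i       = Sum.map (MV⊆PosV p pure y) (MV⊆PosV* ps pures y) i

  basic⇒PosV⊆MV  : ∀ {s} (p : Pat s) → Basic p → PosV p ⊆′ MV p
  basic⇒PosV⊆MV* : ∀ {n} (ps : Vec (Pat val) n) → Basic* ps → PosV* ps ⊆′ MV* ps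
  basic⇒PosV⊆MV (var x)      _        y i = i
  basic⇒PosV⊆MV (node f ps)  b        y i = basic⇒PosV⊆MV* ps b y i
  basic⇒PosV⊆MV (var x at p) b        y i = Sum.map₂ (basic⇒PosV⊆MV p b y) i
  basic⇒PosV⊆MV* (p ∷ ps)    (b , bs) y i = Sum.map (basic⇒PosV⊆MV p b y) (basic⇒PosV⊆MV* ps bs y) i

  basic⇒¬NegV  : ∀ {s} (p : Pat s) → Basic p → ∀ x → ¬ NegV p x
  basic⇒¬NegV* : ∀ {n} (ps : Vec (Pat val) n) → Basic* ps → ∀ x → ¬ NegV* ps x
  basic⇒¬NegV (node f ps)  b        x i        = basic⇒¬NegV* ps b x i
  basic⇒¬NegV (var y at p) b        x i        = basic⇒¬NegV p b x i
  basic⇒¬NegV* (p ∷ ps)    (b , bs) x (inj₁ i) = basic⇒¬NegV p b x i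
  basic⇒¬NegV* (p ∷ ps)    (b , bs) x (inj₂ i) = basic⇒¬NegV* ps bs x i

  basic⇒varAliases  : ∀ {s} (p : Pat s) → Basic p → VarAliases p
  basic⇒varAliases* : ∀ {n} (ps : Vec (Pat val) n) → Basic* ps → VarAliases* ps
  basic⇒varAliases (var x)      _ = tt
  basic⇒varAliases (node f ps)  b = basic⇒varAliases* ps b
  basic⇒varAliases (var x at p) b = (x , refl) , basic⇒varAliases p b
  basic⇒varAliases* []       _        = tt
  basic⇒varAliases* (p ∷ ps) (b , bs) = basic⇒varAliases p b , basic⇒varAliases* ps bs

  basic : ∀ {s} (p : Pat s) → VarAliases p → Avoids sum p → Additive p → Pure p → Basic p
  basic* : ∀ {n} (ps : Vec (Pat val) n) →
           VarAliases* ps → Avoids* sum ps → Additive* ps → Pure* ps → Basic* ps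
  basic (var x)      _ _ _ _ = tt
  basic (node f ps)  a s c b = basic* ps a s c b
  basic (p ⊕ q)      _ (s , _) _ _ = contradiction refl s
  basic (p ∖ q)      _ _ (c , _) _ = contradiction refl c
  basic bot          _ _ _ b = contradiction refl b
  basic (q at p)     ((x , refl) , a) (_ , s) (_ , c) (_ , b) = basic p a s c b
  basic* []       _ _ _ _ = tt
  basic* (p ∷ ps) (a , as) (s , ss) (c , cs) (b , bs) = basic p a s c b , basic* ps as ss cs bs

  linear⇒posLinear  : ∀ {s} (p : Pat s) → Linear p → PosLinear p
  linear⇒posLinear* : ∀ {n} (ps : Vec (Pat val) n) → Linear* ps → PosLinear* ps
  linear⇒posLinear (var x)     _             = tt
  linear⇒posLinear (node f ps) l             = linear⇒posLinear* ps l
  linear⇒posLinear (p ⊕ q)     (l , m)       = linear⇒posLinear p l , linear⇒posLinear q m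
  linear⇒posLinear (p ∖ q)     (l , _)       = linear⇒posLinear p l
  linear⇒posLinear bot         _             = tt
  linear⇒posLinear (q at p)    (_ , l , d)   =
    linear⇒posLinear p l , λ x (i , j) → d (i , PosV⊆varsP p x j)
  linear⇒posLinear* []         _             = tt
  linear⇒posLinear* (p ∷ ps)   (l , ls , d)  =
    linear⇒posLinear p l , linear⇒posLinear* ps ls ,
    λ x (i , j) → d (PosV⊆varsP p x i , PosV⊆varsP* ps x j)

  -- The summands of a linear sum may share variables, so one may bind what the other has under a
  -- complement. The intersection in `MV` settles this: a matchable variable is matchable in the
  -- very summand where it would be negative.
  linear⇒MV⊥NegV  : ∀ {s} (p : Pat s) → Linear p → Pure p → MV p ⊥′ NegV p
  linear⇒MV⊥NegV* : ∀ {n} (ps : Vec (Pat val) n) → Linear* ps → Pure* ps → MV* ps ⊥′ NegV* ps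
  linear⇒MV⊥NegV (node f ps) l pure x i = linear⇒MV⊥NegV* ps l pure x i
  linear⇒MV⊥NegV (p ⊕ q) (l , _) (_ , pure , _) x ((i , _) , inj₁ j) = linear⇒MV⊥NegV p l pure x (i , j)
  linear⇒MV⊥NegV (p ⊕ q) (_ , l) (_ , _ , pure) x ((_ , i) , inj₂ j) = linear⇒MV⊥NegV q l pure x (i , j)
  linear⇒MV⊥NegV (p ∖ q) (l , _) (_ , pure , _) x (i , inj₁ j) = linear⇒MV⊥NegV p l pure x (i , j)
  linear⇒MV⊥NegV (p ∖ q) (_ , _ , d) (_ , pure , _) x (i , inj₂ j) =
    d (PosV⊆varsP p x (MV⊆PosV p pure x i) , j)
  linear⇒MV⊥NegV (q at p) (_ , l , d) (_ , pure) x (inj₁ i , j) = d (i , NegV⊆varsP p x j)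
  linear⇒MV⊥NegV (q at p) (_ , l , d) (_ , pure) x (inj₂ i , j) = linear⇒MV⊥NegV p l pure x (i , j)
  linear⇒MV⊥NegV* (p ∷ ps) (l , _) (pure , _) x (inj₁ i , inj₁ j) = linear⇒MV⊥NegV p l pure x (i , j)
  linear⇒MV⊥NegV* (p ∷ ps) (l , ls , d) (pure , pures) x (inj₁ i , inj₂ j) =
    d (PosV⊆varsP p x (MV⊆PosV p pure x i) , NegV⊆varsP* ps x j)
  linear⇒MV⊥NegV* (p ∷ ps) (l , ls , d) (pure , pures) x (inj₂ i , inj₁ j) =
    d (NegV⊆varsP p x j , PosV⊆varsP* ps x (MV⊆PosV* ps pures x i))
  linear⇒MV⊥NegV* (p ∷ ps) (_ , ls , _) (_ , pures) x (inj₂ i , inj₂ j) = linear⇒MV⊥NegV* ps ls pures x (i , j)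

  -- Monotone in spite of complements, since their right arguments do not consult the valuation;
  -- hence only the variables in `PosV` matter.
  Sat-mono  : ∀ {s ρ ρ′} (p : Pat s) → (∀ x → PosV p x → ρ x ⊆′ ρ′ x) → Sat ρ p ⊆′ Sat ρ′ p
  Sat-mono* : ∀ {n ρ ρ′} (ps : Vec (Pat val) n) →
              (∀ x → PosV* ps x → ρ x ⊆′ ρ′ x) → Sat* ρ ps ⊆′ Sat* ρ′ ps
  Sat-mono (var x)      ρ⊆ v m              = ρ⊆ x refl v m
  Sat-mono (node f ps)  ρ⊆ v (vs , eq , m)  = vs , eq , Sat-mono* ps ρ⊆ vs m
  Sat-mono (p ⊕ q)      ρ⊆ v (inj₁ m)       = inj₁ (Sat-mono p (λ x → ρ⊆ x ∘ inj₁) v m)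
  Sat-mono (p ⊕ q)      ρ⊆ v (inj₂ m)       = inj₂ (Sat-mono q (λ x → ρ⊆ x ∘ inj₂) v m)
  Sat-mono (p ∖ q)      ρ⊆ v (m , ¬n)       = Sat-mono p ρ⊆ v m , ¬n
  Sat-mono (var x at p) ρ⊆ v (k , m)        =
    ρ⊆ x (inj₁ (here refl)) v k , Sat-mono p (λ x → ρ⊆ x ∘ inj₂) v m
  Sat-mono* []       ρ⊆ []       _        = tt
  Sat-mono* (p ∷ ps) ρ⊆ (v ∷ vs) (m , ms) =
    Sat-mono p (λ x → ρ⊆ x ∘ inj₁) v m , Sat-mono* ps (λ x → ρ⊆ x ∘ inj₂) vs ms

  -- Replaces excluded middle, both for locating a component that fails to match and for finding the
  -- first rule that matches.
  Sat-free?  : ∀ {s} (p : Pat s) → Decidable (Sat free p)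
  Sat-free?* : ∀ {n} (ps : Vec (Pat val) n) → Decidable (Sat* free ps)
  Sat-free? (var x)     v = yes tt
  Sat-free? (node (tup n) ps) vs =
    map′ (λ m → vs , refl , m) (λ { (_ , refl , m) → m }) (Sat-free?* ps vs)
  Sat-free? (node (con c) ps) (app d vs) with c Fin.≟ d
  ... | yes refl = map′ (λ m → vs , refl , m) (λ { (_ , refl , m) → m }) (Sat-free?* ps vs)
  ... | no c≢d   = no λ { (_ , refl , _) → c≢d refl }
  Sat-free? (p ⊕ q)        v = Sat-free? p v ⊎-dec Sat-free? q v
  Sat-free? (p ∖ q)        v = Sat-free? p v ×-dec ¬? (Sat-free? q v)
  Sat-free? bot            v = no λ ()
  Sat-free? (var x at p)   v = yes tt ×-dec Sat-free? p v
  Sat-free? (app _ _ at p) v = no λ ()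
  Sat-free?* []       []       = yes tt
  Sat-free?* (p ∷ ps) (v ∷ vs) = Sat-free? p v ×-dec Sat-free?* ps vs

  ⟦pat⟧  : ∀ t → ⟦ pat t ⟧ ≐′ ⟦ t ⟧ᵗ
  ⟦pat⟧* : ∀ {n} (ts : Vec (T⟨C⟩ Var) n) → ⟦ pat* ts ⟧* ≐′ ⟦ ts ⟧ᵗ*
  ⟦pat⟧ (var x) = (λ _ → id) , (λ _ → id)
  ⟦pat⟧ (app c ts) = let to , from = ⟦pat⟧* ts in
    (λ { _ (vs , eq , m) → vs , eq , to vs m }) , (λ { _ (vs , eq , m) → vs , eq , from vs m })
  ⟦pat⟧* [] = (λ { [] → id }) , (λ { [] → id })
  ⟦pat⟧* (t ∷ ts) = let to , from = ⟦pat⟧ t ; to* , from* = ⟦pat⟧* ts in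
    (λ { (v ∷ vs) (m , ms) → to v m , to* vs ms }) ,
    (λ { (v ∷ vs) (m , ms) → from v m , from* vs ms })

  -- By hypothesis every value matches the image of a negative variable, so under a complement
  -- `within σ` and `free` admit the same values and `Sat-mono` passes between them in both
  -- directions.
  ⟦subP⟧  : ∀ {s} σ (p : Pat s) → VarAliases p → (∀ x → NegV p x → ∀ v → within σ x v) →
            ⟦ subP σ p ⟧ ≐′ Sat (within σ) p
  ⟦subP⟧* : ∀ {n} σ (ps : Vec (Pat val) n) →
            VarAliases* ps → (∀ x → NegV* ps x → ∀ v → within σ x v) →
            ⟦ subP* σ ps ⟧* ≐′ Sat* (within σ) ps
  ⟦subP⟧ σ (var x) a u = ⟦pat⟧ (σ x)
  ⟦subP⟧ σ (node f ps) a u = let to , from = ⟦subP⟧* σ ps a u in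
    (λ { _ (vs , eq , m) → vs , eq , to vs m }) , (λ { _ (vs , eq , m) → vs , eq , from vs m })
  ⟦subP⟧ σ (p ⊕ q) (a , b) u =
    let to  , from  = ⟦subP⟧ σ p a λ x → u x ∘ inj₁
        to′ , from′ = ⟦subP⟧ σ q b λ x → u x ∘ inj₂
    in (λ v → Sum.map (to v) (to′ v)) , (λ v → Sum.map (from v) (from′ v))
  ⟦subP⟧ σ (p ∖ q) (a , b) u =
    let to  , from  = ⟦subP⟧ σ p a λ x → u x ∘ inj₁
        to′ , from′ = ⟦subP⟧ σ q b λ x i → u x (inj₂ (NegV⊆varsP q x i))
    in (λ v (m , ¬n) → to v m , λ n → ¬n (from′ v
          (Sat-mono q (λ x i w _ → u x (inj₂ (PosV⊆varsP q x i)) w) v n))) ,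
       (λ v (m , ¬n) → from v m , λ n → ¬n (Sat-mono q (λ _ _ _ _ → tt) v (to′ v n)))
  ⟦subP⟧ σ bot a u = (λ _ → id) , (λ _ → id)
  ⟦subP⟧ σ (q at p) ((x , refl) , a) u = let to , from = ⟦subP⟧ σ p a u in
    (λ { v (k , m) → k , to v m }) , (λ { v (k , m) → k , from v m })
  ⟦subP⟧* σ [] a u = (λ { [] → id }) , (λ { [] → id })
  ⟦subP⟧* σ (p ∷ ps) (a , as) u =
    let to  , from  = ⟦subP⟧ σ p a λ x → u x ∘ inj₁
        to* , from* = ⟦subP⟧* σ ps as λ x → u x ∘ inj₂
    in (λ { (v ∷ vs) (m , ms) → to v m , to* vs ms }) ,
       (λ { (v ∷ vs) (m , ms) → from v m , from* vs ms })

  subP-var  : ∀ {s} (p : Pat s) → subP var p ≡ p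
  subP-var* : ∀ {n} (ps : Vec (Pat val) n) → subP* var ps ≡ ps
  subP-var (var x)     = refl
  subP-var (node f ps) = cong (node f) (subP-var* ps)
  subP-var (p ⊕ q)     = cong₂ _⊕_ (subP-var p) (subP-var q)
  subP-var (p ∖ q)     = cong₂ _∖_ (subP-var p) (subP-var q)
  subP-var bot         = refl
  subP-var (q at p)    = cong₂ _at_ (sub-var q) (subP-var p)
  subP-var* []       = refl
  subP-var* (p ∷ ps) = cong₂ _∷_ (subP-var p) (subP-var* ps)

  -- The identity substitution constrains nothing: `within var` computes to `free`.
  ⟦⟧≐Sat : ∀ {s} (p : Pat s) → VarAliases p → ⟦ p ⟧ ≐′ Sat free p
  ⟦⟧≐Sat p a = subst (λ q → ⟦ q ⟧ ≐′ Sat free p) (subP-var p) (⟦subP⟧ var p a λ _ _ _ → tt)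

-- Replacing a component, and sums of patterns

module Rewriting (S : Signature) where
  open Extended S
  open Semantics S

  Sat*-lookup : ∀ {n ρ} (ps : Vec (Pat val) n) vs i →
                Sat* ρ ps vs → Sat ρ (Vec.lookup ps i) (Vec.lookup vs i)
  Sat*-lookup (p ∷ ps) (v ∷ vs) zero    (m , _)  = m
  Sat*-lookup (p ∷ ps) (v ∷ vs) (suc i) (_ , ms) = Sat*-lookup ps vs i ms

  Sat*-update : ∀ {n ρ p} (ps : Vec (Pat val) n) vs i →
                Sat* ρ ps vs → Sat ρ p (Vec.lookup vs i) → Sat* ρ (ps [ i ]≔ p) vs
  Sat*-update (p ∷ ps) (v ∷ vs) zero    (_ , ms) m = m , ms
  Sat*-update (p ∷ ps) (v ∷ vs) (suc i) (k , ms) m = k , Sat*-update ps vs i ms m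

  Sat*-updated : ∀ {n ρ p} (ps : Vec (Pat val) n) vs i →
                 Sat* ρ (ps [ i ]≔ p) vs → Sat ρ p (Vec.lookup vs i)
  Sat*-updated (p ∷ ps) (v ∷ vs) zero    (m , _)  = m
  Sat*-updated (p ∷ ps) (v ∷ vs) (suc i) (_ , ms) = Sat*-updated ps vs i ms

  Sat*-restore : ∀ {n ρ p} (ps : Vec (Pat val) n) vs i → Sat* ρ (ps [ i ]≔ p) vs →
                 Sat ρ (Vec.lookup ps i) (Vec.lookup vs i) → Sat* ρ ps vs
  Sat*-restore (p ∷ ps) (v ∷ vs) zero    (_ , ms) m = m , ms
  Sat*-restore (p ∷ ps) (v ∷ vs) (suc i) (k , ms) m = k , Sat*-restore ps vs i ms m

  -- The constructive De Morgan law behind M7, obtained by deciding the components one after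
  -- another.
  Sat*-refute : ∀ {n} (ps : Vec (Pat val) n) vs → ¬ Sat* free ps vs →
                ∃[ i ] ¬ Sat free (Vec.lookup ps i) (Vec.lookup vs i)
  Sat*-refute []       []       ¬ms = contradiction tt ¬ms
  Sat*-refute (p ∷ ps) (v ∷ vs) ¬ms with Sat-free? p v
  ... | no ¬m = zero , ¬m
  ... | yes m = let i , ¬k = Sat*-refute ps vs (λ ms → ¬ms (m , ms)) in suc i , ¬k

  Sat-⨁⁺ : ∀ {s ρ v} (ps : List (Pat s)) → Any (λ p → Sat ρ p v) ps → Sat ρ (⨁ ps) v
  Sat-⨁⁺ (p ∷ [])     (here m)  = m
  Sat-⨁⁺ (p ∷ q ∷ ps) (here m)  = inj₁ m
  Sat-⨁⁺ (p ∷ q ∷ ps) (there m) = inj₂ (Sat-⨁⁺ (q ∷ ps) m)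

  Sat-⨁⁻ : ∀ {s ρ v} (ps : List (Pat s)) → Sat ρ (⨁ ps) v → Any (λ p → Sat ρ p v) ps
  Sat-⨁⁻ (p ∷ [])     m        = here m
  Sat-⨁⁻ (p ∷ q ∷ ps) (inj₁ m) = here m
  Sat-⨁⁻ (p ∷ q ∷ ps) (inj₂ m) = there (Sat-⨁⁻ (q ∷ ps) m)

  PosV*-lookup : ∀ {n} (ps : Vec (Pat val) n) i → PosV (Vec.lookup ps i) ⊆′ PosV* ps
  PosV*-lookup (p ∷ ps) zero    x j = inj₁ j
  PosV*-lookup (p ∷ ps) (suc i) x j = inj₂ (PosV*-lookup ps i x j)

  PosV*-update : ∀ {n p} (ps : Vec (Pat val) n) i → PosV* (ps [ i ]≔ p) ⊆′ PosV p ∪ PosV* ps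
  PosV*-update (p ∷ ps) zero    x (inj₁ j) = inj₁ j
  PosV*-update (p ∷ ps) zero    x (inj₂ j) = inj₂ (inj₂ j)
  PosV*-update (p ∷ ps) (suc i) x (inj₁ j) = inj₂ (inj₁ j)
  PosV*-update (p ∷ ps) (suc i) x (inj₂ j) = Sum.map₂ inj₂ (PosV*-update ps i x j)

  PosV-⨁ : ∀ {s} (ps : List (Pat s)) x → PosV (⨁ ps) x → Any (λ p → PosV p x) ps
  PosV-⨁ (p ∷ [])     x j        = here j
  PosV-⨁ (p ∷ q ∷ ps) x (inj₁ j) = here j
  PosV-⨁ (p ∷ q ∷ ps) x (inj₂ j) = there (PosV-⨁ (q ∷ ps) x j)

  MV*-updated : ∀ {n p} (ps : Vec (Pat val) n) i → MV p ⊆′ MV* (ps [ i ]≔ p)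
  MV*-updated (p ∷ ps) zero    x j = inj₁ j
  MV*-updated (p ∷ ps) (suc i) x j = inj₂ (MV*-updated ps i x j)

  MV*-update : ∀ {n p} (ps : Vec (Pat val) n) i →
               MV* ps ⊆′ MV (Vec.lookup ps i) ∪ MV* (ps [ i ]≔ p)
  MV*-update (p ∷ ps) zero    x (inj₁ j) = inj₁ j
  MV*-update (p ∷ ps) zero    x (inj₂ j) = inj₂ (inj₂ j)
  MV*-update (p ∷ ps) (suc i) x (inj₁ j) = inj₂ (inj₁ j)
  MV*-update (p ∷ ps) (suc i) x (inj₂ j) = Sum.map₂ inj₂ (MV*-update ps i x j)

  MV-⨁ : ∀ {s} (ps : List (Pat s)) x → All (λ p → MV p x) ps → MV (⨁ ps) x
  MV-⨁ []           x []       = tt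
  MV-⨁ (p ∷ [])     x (j ∷ []) = j
  MV-⨁ (p ∷ q ∷ ps) x (j ∷ js) = j , MV-⨁ (q ∷ ps) x js

  posLinear-⨁ : ∀ {s} (ps : List (Pat s)) → All PosLinear ps → PosLinear (⨁ ps)
  posLinear-⨁ []           []       = tt
  posLinear-⨁ (p ∷ [])     (l ∷ []) = l
  posLinear-⨁ (p ∷ q ∷ ps) (l ∷ ls) = l , posLinear-⨁ (q ∷ ps) ls

  posLinear*-lookup : ∀ {n} (ps : Vec (Pat val) n) i → PosLinear* ps → PosLinear (Vec.lookup ps i)
  posLinear*-lookup (p ∷ ps) zero    (l , _)      = l
  posLinear*-lookup (p ∷ ps) (suc i) (_ , ls , _) = posLinear*-lookup ps i ls

  posLinear*-update : ∀ {n p} (ps : Vec (Pat val) n) i → PosLinear* ps → PosLinear p →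
                      PosV p ⊆′ PosV (Vec.lookup ps i) ∪ ∁ (PosV* ps) → PosLinear* (ps [ i ]≔ p)
  posLinear*-update {p = q} (p ∷ ps) zero (_ , ls , d) k ⊆ = k , ls , disj
    where
    disj : PosV q ⊥′ PosV* ps
    disj x (i , j) with ⊆ x i
    ... | inj₁ i′ = d x (i′ , j)
    ... | inj₂ ∉  = ∉ (inj₂ j)
  posLinear*-update {p = q} (p ∷ ps) (suc i) (l , ls , d) k ⊆ =
    l , posLinear*-update ps i ls k (λ x j → Sum.map₂ (_∘ inj₂) (⊆ x j)) , disj
    where
    disj : PosV p ⊥′ PosV* (ps [ i ]≔ q)
    disj x (j , j′) with PosV*-update ps i x j′
    ... | inj₂ j″ = d x (j , j″)
    ... | inj₁ j″ with ⊆ x j″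
    ...   | inj₁ k = d x (j , PosV*-lookup ps i x k)
    ...   | inj₂ ∉ = ∉ (inj₁ j)

  varAliases-⨁ : ∀ {s} (ps : List (Pat s)) → All VarAliases ps → VarAliases (⨁ ps)
  varAliases-⨁ []           []       = tt
  varAliases-⨁ (p ∷ [])     (a ∷ []) = a
  varAliases-⨁ (p ∷ q ∷ ps) (a ∷ as) = a , varAliases-⨁ (q ∷ ps) as

  varAliases*-lookup : ∀ {n} (ps : Vec (Pat val) n) i → VarAliases* ps → VarAliases (Vec.lookup ps i)
  varAliases*-lookup (p ∷ ps) zero    (a , _)  = a
  varAliases*-lookup (p ∷ ps) (suc i) (_ , as) = varAliases*-lookup ps i as

  varAliases*-update : ∀ {n p} (ps : Vec (Pat val) n) i →
                       VarAliases* ps → VarAliases p → VarAliases* (ps [ i ]≔ p)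
  varAliases*-update (p ∷ ps) zero    (_ , as) b = b , as
  varAliases*-update (p ∷ ps) (suc i) (a , as) b = a , varAliases*-update ps i as b

  -- Closing invariants under contexts

  module _ {R : ∀ {s} → Pat s → Pat s → Set} where

    -- Φ will require that fresh variables are free.  In the right argument of a
    -- complement the valuation becomes free, hence the assumption Φ free.
    cong-Sat : (Φ : Pred Valuation 0ℓ) → Φ free →
               (∀ {s} {p p′ : Pat s} → R p p′ → ∀ ρ → Φ ρ → Sat ρ p ≐′ Sat ρ p′) →
               ∀ {s} {p p′ : Pat s} → Cong R p p′ → ∀ ρ → Φ ρ → Sat ρ p ≐′ Sat ρ p′
    cong-Sat Φ φ base (root r) ρ ok = base r ρ ok
    cong-Sat Φ φ base (inNode {ps = ps} i r) ρ ok =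
      let to , from = cong-Sat Φ φ base r ρ ok in
      (λ { _ (vs , eq , m) → vs , eq ,
           Sat*-update ps vs i m (to _ (Sat*-lookup ps vs i m)) }) ,
      (λ { _ (vs , eq , m) → vs , eq ,
           Sat*-restore ps vs i m (from _ (Sat*-updated ps vs i m)) })
    cong-Sat Φ φ base (in⊕ˡ r) ρ ok =
      let to , from = cong-Sat Φ φ base r ρ ok in (Sum.map₁ ∘ to) , (Sum.map₁ ∘ from)
    cong-Sat Φ φ base (in⊕ʳ r) ρ ok =
      let to , from = cong-Sat Φ φ base r ρ ok in (Sum.map₂ ∘ to) , (Sum.map₂ ∘ from)
    cong-Sat Φ φ base (in∖ˡ r) ρ ok =
      let to , from = cong-Sat Φ φ base r ρ ok in
      (λ v (m , ¬n) → to v m , ¬n) , (λ v (m , ¬n) → from v m , ¬n)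
    cong-Sat Φ φ base (in∖ʳ r) ρ ok =
      let to , from = cong-Sat Φ φ base r free φ in
      (λ v (m , ¬n) → m , ¬n ∘ from v) , (λ v (m , ¬n) → m , ¬n ∘ to v)
    cong-Sat Φ φ base (inAt {q = var x} r) ρ ok =
      let to , from = cong-Sat Φ φ base r ρ ok in
      (λ v (k , m) → k , to v m) , (λ v (k , m) → k , from v m)
    cong-Sat Φ φ base (inAt {q = app _ _} r) ρ ok = (λ _ ()) , (λ _ ())

    cong-varAliases : (∀ {s} {p p′ : Pat s} → R p p′ → VarAliases p → VarAliases p′) →
                      ∀ {s} {p p′ : Pat s} → Cong R p p′ → VarAliases p → VarAliases p′
    cong-varAliases base (root r) a = base r a
    cong-varAliases base (inNode {ps = ps} i r) a =
      varAliases*-update ps i a (cong-varAliases base r (varAliases*-lookup ps i a))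
    cong-varAliases base (in⊕ˡ r) (a , b) = cong-varAliases base r a , b
    cong-varAliases base (in⊕ʳ r) (a , b) = a , cong-varAliases base r b
    cong-varAliases base (in∖ˡ r) (a , b) = cong-varAliases base r a , b
    cong-varAliases base (in∖ʳ r) (a , b) = a , cong-varAliases base r b
    cong-varAliases base (inAt r) (x , a) = x , cong-varAliases base r a

    -- `X` holds the variables that a step may lose: none for rewriting, the alias variable for
    -- alias removal.
    cong-MV : (X : Pred Var 0ℓ) → (∀ {s} {p p′ : Pat s} → R p p′ → MV p ⊆′ X ∪ MV p′) →
              ∀ {s} {p p′ : Pat s} → Cong R p p′ → MV p ⊆′ X ∪ MV p′
    cong-MV X base (root r) = base r
    cong-MV X base (inNode {ps = ps} i r) x j with MV*-update ps i x j
    ... | inj₁ k = Sum.map₂ (MV*-updated ps i x) (cong-MV X base r x k)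
    ... | inj₂ k = inj₂ k
    cong-MV X base (in⊕ˡ r) x (j , k) = Sum.map₂ (_, k) (cong-MV X base r x j)
    cong-MV X base (in⊕ʳ r) x (j , k) = Sum.map₂ (j ,_) (cong-MV X base r x k)
    cong-MV X base (in∖ˡ r) x j = cong-MV X base r x j
    cong-MV X base (in∖ʳ r) x j = inj₂ j
    cong-MV X base (inAt r) x (inj₁ j) = inj₂ (inj₁ j)
    cong-MV X base (inAt r) x (inj₂ j) = Sum.map₂ inj₂ (cong-MV X base r x j)

    -- The complement of `W` holds the variables that a step may introduce. Rewriting takes for `W`
    -- the variables used so far; alias removal takes `U`, so that nothing new can appear.
    cong-PosV : (W : Pred Var 0ℓ) → (∀ {s} {p p′ : Pat s} → R p p′ → PosV p′ ⊆′ PosV p ∪ ∁ W) →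
              ∀ {s} {p p′ : Pat s} → Cong R p p′ → PosV p′ ⊆′ PosV p ∪ ∁ W
    cong-PosV W base (root r) = base r
    cong-PosV W base (inNode {ps = ps} i r) x j with PosV*-update ps i x j
    ... | inj₁ k = Sum.map₁ (PosV*-lookup ps i x) (cong-PosV W base r x k)
    ... | inj₂ k = inj₁ k
    cong-PosV W base (in⊕ˡ r) x (inj₁ j) = Sum.map₁ inj₁ (cong-PosV W base r x j)
    cong-PosV W base (in⊕ˡ r) x (inj₂ j) = inj₁ (inj₂ j)
    cong-PosV W base (in⊕ʳ r) x (inj₁ j) = inj₁ (inj₁ j)
    cong-PosV W base (in⊕ʳ r) x (inj₂ j) = Sum.map₁ inj₂ (cong-PosV W base r x j)
    cong-PosV W base (in∖ˡ r) x j = cong-PosV W base r x j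
    cong-PosV W base (in∖ʳ r) x j = inj₁ j
    cong-PosV W base (inAt r) x (inj₁ j) = inj₁ (inj₁ j)
    cong-PosV W base (inAt r) x (inj₂ j) = Sum.map₁ inj₂ (cong-PosV W base r x j)

    -- What a step introduces lies outside `W`, while the siblings of the rewritten subpattern only
    -- have variables in `W`; hence no clash arises in the context.
    cong-posLinear : (W : Pred Var 0ℓ) →
                     (∀ {s} {p p′ : Pat s} → R p p′ → PosV p′ ⊆′ PosV p ∪ ∁ W) →
                     (∀ {s} {p p′ : Pat s} → R p p′ → PosV p ⊆′ W → PosLinear p → PosLinear p′) →
                     ∀ {s} {p p′ : Pat s} → Cong R p p′ →
                     PosV p ⊆′ W → PosLinear p → PosLinear p′
    cong-posLinear W pv base (root r) ⊆W l = base r ⊆W l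
    cong-posLinear W pv base (inNode {ps = ps} i r) ⊆W l =
      posLinear*-update ps i l
        (cong-posLinear W pv base r (λ x j → ⊆W x (PosV*-lookup ps i x j)) (posLinear*-lookup ps i l))
        (λ x j → Sum.map₂ (λ ∉W k → ∉W (⊆W x k)) (cong-PosV W pv r x j))
    cong-posLinear W pv base (in⊕ˡ r) ⊆W (l , m) = cong-posLinear W pv base r (λ x → ⊆W x ∘ inj₁) l , m
    cong-posLinear W pv base (in⊕ʳ r) ⊆W (l , m) = l , cong-posLinear W pv base r (λ x → ⊆W x ∘ inj₂) m
    cong-posLinear W pv base (in∖ˡ r) ⊆W l = cong-posLinear W pv base r ⊆W l
    cong-posLinear W pv base (in∖ʳ r) ⊆W l = l
    cong-posLinear W pv base (inAt {q = q} {p} {p′} r) ⊆W (l , d) =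
      cong-posLinear W pv base r (λ x → ⊆W x ∘ inj₂) l , disj
      where
      disj : (_∈ vars q) ⊥′ PosV p′
      disj x (i , j) with cong-PosV W pv r x j
      ... | inj₁ k  = d x (i , k)
      ... | inj₂ ∉W = ∉W (⊆W x (inj₁ i))

  -- The sum of all constructors over generated variables

  varAliases-vars : ∀ {n} (zs : Vec Var n) → VarAliases* (Vec.map var zs)
  varAliases-vars []       = tt
  varAliases-vars (z ∷ zs) = tt , varAliases-vars zs

  PosV-vars : ∀ {n} (zs : Vec Var n) → PosV* (Vec.map var zs) ⊆′ (_∈ Vec.toList zs)
  PosV-vars (z ∷ zs) _ (inj₁ refl) = here refl
  PosV-vars (z ∷ zs) x (inj₂ j)    = there (PosV-vars zs x j)

  posLinear-vars : ∀ {n} (zs : Vec Var n) → Unique (Vec.toList zs) → PosLinear* (Vec.map var zs)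
  posLinear-vars []       _        = tt
  posLinear-vars (z ∷ zs) (z∉ ∷ u) =
    tt , posLinear-vars zs u , λ { _ (refl , j) → All.lookup z∉ (PosV-vars zs _ j) refl }

  Sat-vars : ∀ {n ρ} (zs : Vec Var n) vs → (∀ z → z ∈ Vec.toList zs → ∀ v → ρ z v) →
             Sat* ρ (Vec.map var zs) vs
  Sat-vars []       []       _  = tt
  Sat-vars (z ∷ zs) (v ∷ vs) ok = ok z (here refl) v , Sat-vars zs vs λ y → ok y ∘ there

  module _ (zs : ∀ c → Vec Var (arity-con c)) where

    private
      summand : Con → Pat val
      summand c = node (con c) (Vec.map var (zs c))

    PosV-allCons : ∀ x → PosV (allCons zs) x → ∃[ c ] x ∈ Vec.toList (zs c)
    PosV-allCons x j =
      let c , k = Any.satisfied (Any.map⁻ {f = summand} (PosV-⨁ (map summand (allFin _)) x j)) in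
      c , PosV-vars (zs c) x k

    posLinear-allCons : (∀ c → Unique (Vec.toList (zs c))) → PosLinear (allCons zs)
    posLinear-allCons u = posLinear-⨁ (map summand (allFin _))
      (All.map⁺ (All.universal (λ c → posLinear-vars (zs c) (u c)) (allFin _)))

    varAliases-allCons : VarAliases (allCons zs)
    varAliases-allCons = varAliases-⨁ (map summand (allFin _))
      (All.map⁺ (All.universal (λ c → varAliases-vars (zs c)) (allFin _)))

    -- Every value has some constructor at its root, and the arguments of the corresponding summand
    -- are unconstrained variables.
    Sat-allCons : ∀ {ρ} → (∀ c z → z ∈ Vec.toList (zs c) → ∀ v → ρ z v) → ∀ v → Sat ρ (allCons zs) v
    Sat-allCons ok v with unbuild v
    ... | c , vs , eq =
      Sat-⨁⁺ _ (Any.map⁺ (lose (∈-allFin c) (vs , eq , Sat-vars (zs c) vs (ok c))))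

  -- The individual rewrite rules

  module _ {W : List Var} where

    rewrite-Sat : ∀ {s} {p p′ : Pat s} → Rewrite W p p′ →
                  ∀ ρ → (∀ z → z ∉ W → ∀ v → ρ z v) → Sat ρ p ≐′ Sat ρ p′
    rewrite-Sat (A1 _) ρ ok = (λ { v (inj₂ m) → m }) , (λ _ → inj₂)
    rewrite-Sat (A2 _) ρ ok = (λ { v (inj₁ m) → m }) , (λ _ → inj₁)
    rewrite-Sat (E1 {vs = ps} i _ eq) ρ ok =
      (λ { _ (vs , _ , m) → subst (λ p → Sat ρ p (Vec.lookup vs i)) eq (Sat*-lookup ps vs i m) }) ,
      (λ _ ())
    rewrite-Sat E2 ρ ok = (λ _ → proj₂) , (λ _ ())
    rewrite-Sat (S1 {h = h} {ps} {p} {q} i _ eq) ρ ok = to , from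
      where
      to : Sat ρ (node h ps) ⊆′ Sat ρ (node h (ps [ i ]≔ p) ⊕ node h (ps [ i ]≔ q))
      to v (vs , e , m) with subst (λ p → Sat ρ p (Vec.lookup vs i)) eq (Sat*-lookup ps vs i m)
      ... | inj₁ k = inj₁ (vs , e , Sat*-update ps vs i m k)
      ... | inj₂ k = inj₂ (vs , e , Sat*-update ps vs i m k)
      from : Sat ρ (node h (ps [ i ]≔ p) ⊕ node h (ps [ i ]≔ q)) ⊆′ Sat ρ (node h ps)
      from v (inj₁ (vs , e , m)) = vs , e , Sat*-restore ps vs i m
        (subst (λ p → Sat ρ p (Vec.lookup vs i)) (sym eq) (inj₁ (Sat*-updated ps vs i m)))
      from v (inj₂ (vs , e , m)) = vs , e , Sat*-restore ps vs i m
        (subst (λ p → Sat ρ p (Vec.lookup vs i)) (sym eq) (inj₂ (Sat*-updated ps vs i m)))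
    rewrite-Sat (S2 _ _) ρ ok =
      (λ v (k , m) → Sum.map (k ,_) (k ,_) m) ,
      (λ { v (inj₁ (k , m)) → k , inj₁ m ; v (inj₂ (k , m)) → k , inj₂ m })
    -- Under a complement a variable is matched by every value, whatever ρ says about it.
    rewrite-Sat (M1 _) ρ ok = (λ v (_ , ¬⊤) → ¬⊤ tt) , (λ _ ())
    rewrite-Sat (M2 _) ρ ok = (λ _ → proj₁) , (λ v m → m , id)
    rewrite-Sat (M3 _ _ _) ρ ok =
      (λ v (m , ¬n) → (m , ¬n ∘ inj₁) , ¬n ∘ inj₂) ,
      (λ v ((m , ¬n₁) , ¬n₂) → m , Sum.[ ¬n₁ , ¬n₂ ])
    -- The generated variables avoid `W`, outside which ρ admits all values, so the added sum of
    -- constructors is matched by every value.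
    rewrite-Sat (M4' _ _ zs _ fresh) ρ ok =
      (λ v (k , ¬n) → k , Sat-allCons zs (λ c z z∈ → ok z λ z∈W → fresh c (z∈W , z∈)) v , ¬n) ,
      (λ v (k , _ , ¬n) → k , ¬n)
    rewrite-Sat (M5 _) ρ ok = (λ _ → proj₁) , (λ _ ())
    rewrite-Sat (M6 _ _ _) ρ ok =
      (λ v (m , ¬n) → Sum.map (_, ¬n) (_, ¬n) m) ,
      (λ { v (inj₁ (m , ¬n)) → inj₁ m , ¬n ; v (inj₂ (m , ¬n)) → inj₂ m , ¬n })
    rewrite-Sat (M7 {f = f} {ps} {ts} _ _ _) ρ ok = to , from
      where
      summand : Fin (arity f) → Pat _
      summand i = node f (ps [ i ]≔ (Vec.lookup ps i ∖ Vec.lookup ts i))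
      to : Sat ρ (node f ps ∖ node f ts) ⊆′ Sat ρ (⨁ (tabulate summand))
      to v ((vs , eq , m) , ¬n) =
        let i , ¬k = Sat*-refute ts vs λ k → ¬n (vs , eq , k) in
        Sat-⨁⁺ _ (Any.tabulate⁺ i (vs , eq , Sat*-update ps vs i m (Sat*-lookup ps vs i m , ¬k)))
      from : Sat ρ (⨁ (tabulate summand)) ⊆′ Sat ρ (node f ps ∖ node f ts)
      from v m with Any.tabulate⁻ (Sat-⨁⁻ (tabulate summand) m)
      ... | i , vs , eq , k with Sat*-updated ps vs i k
      -- The failing component refers to one decomposition of the value, a supposed match of `ts` to
      -- another; injectivity of `build` identifies the two.
      ...   | kᵢ , ¬nᵢ = (vs , eq , Sat*-restore ps vs i k kᵢ) , λ { (ws , eq′ , n) → ¬nᵢ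
        (subst (λ us → Sat free (Vec.lookup ts i) (Vec.lookup us i))
               (build-injective f (trans (sym eq′) eq)) (Sat*-lookup ts ws i n)) }
    rewrite-Sat (M8 {f = f} {g} f≢g _ _) ρ ok =
      (λ _ → proj₁) ,
      (λ { v (vs , eq , m) → (vs , eq , m) ,
           λ { (ws , eq′ , _) → f≢g (build-symbol f g (trans (sym eq) eq′)) } })
    rewrite-Sat (M9 _ _) ρ ok =
      (λ v ((k , m) , ¬n) → k , m , ¬n) , (λ v (k , m , ¬n) → (k , m) , ¬n)
    rewrite-Sat (M10 _ _) ρ ok =
      (λ v (m , ¬n) → m , λ n → ¬n (tt , n)) , (λ v (m , ¬n) → m , ¬n ∘ proj₂)

    rewrite-varAliases : ∀ {s} {p p′ : Pat s} → Rewrite W p p′ → VarAliases p → VarAliases p′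
    rewrite-varAliases (A1 _) (_ , a) = a
    rewrite-varAliases (A2 _) (a , _) = a
    rewrite-varAliases (E1 _ _ _) _ = tt
    rewrite-varAliases E2 _ = tt
    rewrite-varAliases (S1 {vs = ps} i _ eq) a =
      let b , c = subst VarAliases eq (varAliases*-lookup ps i a) in
      varAliases*-update ps i a b , varAliases*-update ps i a c
    rewrite-varAliases (S2 _ _) (x , a , b) = (x , a) , (x , b)
    rewrite-varAliases (M1 _) _ = tt
    rewrite-varAliases (M2 _) (a , _) = a
    rewrite-varAliases (M3 _ _ _) (a , b , c) = (a , b) , c
    rewrite-varAliases (M4' {x = x} _ _ zs _ _) (_ , a) = (x , refl) , varAliases-allCons zs , a
    rewrite-varAliases (M5 _) _ = tt
    rewrite-varAliases (M6 _ _ _) ((a , b) , c) = (a , c) , (b , c)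
    rewrite-varAliases (M7 {vs = ps} {ts} _ _ _) (a , b) = varAliases-⨁ _ (All.tabulate⁺ λ i →
      varAliases*-update ps i a (varAliases*-lookup ps i a , varAliases*-lookup ts i b))
    rewrite-varAliases (M8 _ _ _) (a , _) = a
    rewrite-varAliases (M9 _ _) ((x , a) , b) = x , a , b
    rewrite-varAliases (M10 _ _) (a , _ , b) = a , b

    -- In general only an inclusion holds: M1, and M7 on a constant, produce `bot`, for which every
    -- variable counts as matchable, and M4' can add generated variables.
    rewrite-MV : ∀ {s} {p p′ : Pat s} → Rewrite W p p′ → MV p ⊆′ ∅ ∪ MV p′
    rewrite-MV (A1 _) x (_ , j) = inj₂ j
    rewrite-MV (A2 _) x (j , _) = inj₂ j
    rewrite-MV (E1 _ _ _) x j = inj₂ tt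
    rewrite-MV E2 x j = inj₂ tt
    rewrite-MV (S1 {h = h} {ps} {p} {q} i _ eq) x j = inj₂ (side p proj₁ , side q proj₂)
      where
      side : ∀ r → (MV p x × MV q x → MV r x) → MV* (ps [ i ]≔ r) x
      side r f with MV*-update {p = r} ps i x j
      ... | inj₁ k = MV*-updated ps i x (f (subst (λ p → MV p x) eq k))
      ... | inj₂ k = k
    rewrite-MV (S2 _ _) x (inj₁ j) = inj₂ (inj₁ j , inj₁ j)
    rewrite-MV (S2 _ _) x (inj₂ (j , k)) = inj₂ (inj₂ j , inj₂ k)
    rewrite-MV (M1 _) x j = inj₂ tt
    rewrite-MV (M2 _) x j = inj₂ j
    rewrite-MV (M3 _ _ _) x j = inj₂ j
    rewrite-MV (M4' _ _ _ _ _) x refl = inj₂ (inj₁ (here refl))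
    rewrite-MV (M5 _) x j = inj₂ tt
    rewrite-MV (M6 _ _ _) x j = inj₂ j
    rewrite-MV (M7 {f = f} {ps} {ts} _ _ _) x j = inj₂ (MV-⨁ _ x (All.tabulate⁺ summand))
      where
      summand : ∀ i → MV* (ps [ i ]≔ (Vec.lookup ps i ∖ Vec.lookup ts i)) x
      summand i with MV*-update {p = Vec.lookup ps i ∖ Vec.lookup ts i} ps i x j
      ... | inj₁ k = MV*-updated ps i x k
      ... | inj₂ k = k
    rewrite-MV (M8 _ _ _) x j = inj₂ j
    rewrite-MV (M9 _ _) x j = inj₂ j
    rewrite-MV (M10 _ _) x j = inj₂ j

    PosV*-update⊆ : ∀ {n p} (ps : Vec (Pat val) n) i → PosV p ⊆′ PosV (Vec.lookup ps i) →
                  PosV* (ps [ i ]≔ p) ⊆′ PosV* ps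
    PosV*-update⊆ ps i p⊆ x j = Sum.[ PosV*-lookup ps i x ∘ p⊆ x , id ] (PosV*-update ps i x j)

    rewrite-PosV : ∀ {s} {p p′ : Pat s} → Rewrite W p p′ → PosV p′ ⊆′ PosV p ∪ ∁ (_∈ W)
    rewrite-PosV (A1 _) x j = inj₁ (inj₂ j)
    rewrite-PosV (A2 _) x j = inj₁ (inj₁ j)
    rewrite-PosV (S1 {vs = ps} {p} i _ eq) x (inj₁ j) =
      inj₁ (PosV*-update⊆ ps i (λ y k → subst (λ p → PosV p y) (sym eq) (inj₁ k)) x j)
    rewrite-PosV (S1 {vs = ps} {p} i _ eq) x (inj₂ j) =
      inj₁ (PosV*-update⊆ ps i (λ y k → subst (λ p → PosV p y) (sym eq) (inj₂ k)) x j)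
    rewrite-PosV (S2 _ _) x (inj₁ j) = inj₁ (Sum.map₂ inj₁ j)
    rewrite-PosV (S2 _ _) x (inj₂ j) = inj₁ (Sum.map₂ inj₂ j)
    rewrite-PosV (M2 _) x j = inj₁ j
    rewrite-PosV (M3 _ _ _) x j = inj₁ j
    rewrite-PosV (M4' _ _ _ _ _) x (inj₁ (here refl)) = inj₁ refl
    rewrite-PosV (M4' _ _ zs _ fresh) x (inj₂ j) =
      let c , z∈ = PosV-allCons zs x j in inj₂ λ z∈W → fresh c (z∈W , z∈)
    rewrite-PosV (M6 _ _ _) x j = inj₁ j
    rewrite-PosV (M7 {vs = ps} {ts} _ _ _) x j =
      let i , k = Any.tabulate⁻ (PosV-⨁ _ x j) in inj₁ (PosV*-update⊆ ps i (λ _ → id) x k)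
    rewrite-PosV (M8 _ _ _) x j = inj₁ j
    rewrite-PosV (M9 _ _) x j = inj₁ j
    rewrite-PosV (M10 _ _) x j = inj₁ j

    rewrite-posLinear : ∀ {s} {p p′ : Pat s} → Rewrite W p p′ →
                        PosV p ⊆′ (_∈ W) → PosLinear p → PosLinear p′
    rewrite-posLinear (A1 _) _ (_ , l) = l
    rewrite-posLinear (A2 _) _ (l , _) = l
    rewrite-posLinear (E1 _ _ _) _ _ = tt
    rewrite-posLinear E2 _ _ = tt
    rewrite-posLinear (S1 {vs = ps} i _ eq) _ l =
      let k , m = subst PosLinear eq (posLinear*-lookup ps i l) in
      posLinear*-update ps i l k (λ x j → inj₁ (subst (λ p → PosV p x) (sym eq) (inj₁ j))) ,
      posLinear*-update ps i l m (λ x j → inj₁ (subst (λ p → PosV p x) (sym eq) (inj₂ j)))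
    rewrite-posLinear (S2 _ _) _ ((l , m) , d) =
      (l , λ x (i , j) → d x (i , inj₁ j)) , (m , λ x (i , j) → d x (i , inj₂ j))
    rewrite-posLinear (M1 _) _ _ = tt
    rewrite-posLinear (M2 _) _ l = l
    rewrite-posLinear (M3 _ _ _) _ l = l
    rewrite-posLinear (M4' _ _ zs u fresh) ⊆W _ = posLinear-allCons zs u ,
      λ { _ (here refl , j) → let c , z∈ = PosV-allCons zs _ j in fresh c (⊆W _ refl , z∈) }
    rewrite-posLinear (M5 _) _ _ = tt
    rewrite-posLinear (M6 _ _ _) _ l = l
    rewrite-posLinear (M7 {vs = ps} _ _ _) _ l = posLinear-⨁ _ (All.tabulate⁺ λ i →
      posLinear*-update ps i l (posLinear*-lookup ps i l) (λ x → inj₁))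
    rewrite-posLinear (M8 _ _ _) _ l = l
    rewrite-posLinear (M9 _ _) _ l = l
    rewrite-posLinear (M10 _ _) _ l = l

  record Reduct {s} (W : List Var) (p q : Pat s) : Set₁ where
    field
      normal     : Normal q
      varAliases : VarAliases q
      posLinear  : PosLinear q
      MV⊆        : MV p ⊆′ MV q
      Sat≐       : ∀ ρ → (∀ z → z ∉ W → ∀ v → ρ z v) → Sat ρ p ≐′ Sat ρ q

  reduct : ∀ {s W} {p q : Pat s} → W ⊢ p ⇓ q →
           VarAliases p → PosLinear p → PosV p ⊆′ (_∈ W) → Reduct W p q
  reduct (stop normal) a l _ = record
    { normal = normal ; varAliases = a ; posLinear = l ; MV⊆ = λ _ → id
    ; Sat≐ = λ _ _ → (λ _ → id) , (λ _ → id) }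
  reduct {W = W} {p} (step {p' = p′} r rs) a l ⊆W = record
    { normal     = normal
    ; varAliases = varAliases
    ; posLinear  = posLinear
    ; MV⊆        = λ x j → MV⊆ x (Sum.[ ⊥-elim , id ] (cong-MV ∅ rewrite-MV r x j))
    ; Sat≐       = λ ρ ok →
        let to  , from  = cong-Sat (λ ρ → ∀ z → z ∉ W → ∀ v → ρ z v) (λ _ _ _ → tt) rewrite-Sat r ρ ok
            to′ , from′ = Sat≐ ρ λ z z∉ → ok z (z∉ ∘ ∈-++⁺ʳ (varsP p′))
        in (λ v → to′ v ∘ to v) , (λ v → from v ∘ from′ v)
    }
    where
    open Reduct (reduct rs (cong-varAliases rewrite-varAliases r a)
                           (cong-posLinear (_∈ W) rewrite-PosV rewrite-posLinear r ⊆W l)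
                           (λ x j → ∈-++⁺ˡ (PosV⊆varsP p′ x j)))

-- The shape of normal forms

module NormalForms (S : Signature) where
  open Extended S
  open Semantics S
  open Rewriting S

  toList-tabulate : ∀ {A : Set} {n} (f : Fin n → A) → Vec.toList (Vec.tabulate f) ≡ tabulate f
  toList-tabulate {n = ℕ.zero}  f = refl
  toList-tabulate {n = ℕ.suc n} f = cong (f zero ∷_) (toList-tabulate (f ∘ suc))

  distinct : ∀ n → Unique (Vec.toList (Vec.tabulate {n = n} Fin.toℕ))
  distinct n = subst Unique (sym (toList-tabulate {n = n} Fin.toℕ)) (Unique.tabulate⁺ toℕ-injective)

  avoids* : ∀ {n o} (ps : Vec (Pat val) n) → (∀ i → Avoids o (Vec.lookup ps i)) → Avoids* o ps
  avoids* []       _ = tt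
  avoids* (p ∷ ps) a = a zero , avoids* ps (a ∘ suc)

  -- M4' and M7 accept only a pure right argument. This is why a normal right argument must be known
  -- to be either `bot` itself or free of `bot`.
  complement-reducible : ∀ {s} (p q : Pat s) → VarAliases p → VarAliases q →
                         Additive p → Additive q → q ≡ bot ⊎ Pure q →
                         ∃[ r ] Rewrite [] (p ∖ q) r
  complement-reducible p             (var x)     _ _ a b _ = _ , M1 a
  complement-reducible p             (q ⊕ r)     _ _ a (_ , b , c) _ = _ , M3 a b c
  complement-reducible p             (_ ∖ _)     _ _ _ (c , _) _ = contradiction refl c
  complement-reducible p             bot         _ _ a _ _ = _ , M2 a
  complement-reducible p             (_ at q)    _ ((x , refl) , _) a (_ , b) _ = _ , M10 a b
  complement-reducible (var x)       (node g ts) _ _ _ b (inj₂ pure) =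
    -- `Normal` forbids steps for every list of used variables. With the empty list freshness is
    -- vacuous, and the names 0, 1, ... need only be distinct within each constructor.
    _ , M4' pure b (λ c → Vec.tabulate Fin.toℕ) (λ c → distinct (arity-con c)) (λ _ ())
  complement-reducible (node f ps)   (node g ts) _ _ a b (inj₂ pure) with symbol≟ f g
  ... | yes refl = _ , M7 a pure b
  ... | no f≢g   = _ , M8 f≢g a b
  complement-reducible (p ⊕ q)       (node g ts) _ _ (_ , a , b) c _ = _ , M6 a b c
  complement-reducible (_ ∖ _)       (node g ts) _ _ (c , _) _ _ = contradiction refl c
  complement-reducible bot           (node g ts) _ _ _ b _ = _ , M5 b
  complement-reducible (_ at p)      (node g ts) ((x , refl) , _) _ (_ , a) b _ = _ , M9 a b

  -- Both claims need each other in the induction: propagating `bot` by A1, A2 and E1 requires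
  -- additive siblings, while eliminating a complement requires a right argument that is `bot` or
  -- pure.
  normal-form  : ∀ {s} (p : Pat s) → VarAliases p → Normal p → Additive p × (p ≡ bot ⊎ Pure p)
  normal-form* : ∀ {n} (ps : Vec (Pat val) n) → VarAliases* ps → (∀ i → Normal (Vec.lookup ps i)) →
                 ∀ i → Additive (Vec.lookup ps i) × (Vec.lookup ps i ≡ bot ⊎ Pure (Vec.lookup ps i))
  normal-form (var x) _ _ = tt , inj₂ tt
  normal-form (node f ps) a n = additive , inj₂ (avoids* ps pure)
    where
    children = normal-form* ps a λ i → n ∘ inNode i
    additive = avoids* ps (proj₁ ∘ children)
    pure : ∀ i → Pure (Vec.lookup ps i)
    pure i with proj₂ (children i)
    ... | inj₁ eq = contradiction (root (E1 i additive eq)) (n {[]})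
    ... | inj₂ b  = b
  normal-form (p ⊕ q) (a , b) n with normal-form p a (n ∘ in⊕ˡ) | normal-form q b (n ∘ in⊕ʳ)
  ... | c , inj₁ refl | d , _         = contradiction (root (A1 d)) (n {[]})
  ... | c , inj₂ _    | d , inj₁ refl = contradiction (root (A2 c)) (n {[]})
  ... | c , inj₂ e    | d , inj₂ f    = ((λ ()) , c , d) , inj₂ ((λ ()) , e , f)
  normal-form (p ∖ q) (a , b) n =
    let c , _ = normal-form p a (n ∘ in∖ˡ)
        d , e = normal-form q b (n ∘ in∖ʳ)
        _ , r = complement-reducible p q a b c d e
    in contradiction (root r) n
  normal-form bot _ _ = (λ ()) , inj₁ refl
  normal-form (_ at p) ((x , refl) , a) n with normal-form p a (n ∘ inAt)
  ... | c , inj₁ refl = contradiction (root E2) (n {[]})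
  ... | c , inj₂ e    = ((λ ()) , c) , inj₂ ((λ ()) , e)
  normal-form* (p ∷ ps) (a , as) n zero    = normal-form p a (n zero)
  normal-form* (p ∷ ps) (a , as) n (suc i) = normal-form* ps as (n ∘ suc) i

  -- Binding the variables of basic patterns

  basic*-lookup : ∀ {n} (ps : Vec (Pat val) n) i → Basic* ps → Basic (Vec.lookup ps i)
  basic*-lookup (p ∷ ps) zero    (b , _)  = b
  basic*-lookup (p ∷ ps) (suc i) (_ , bs) = basic*-lookup ps i bs

  -- Linearity lets the parts bind disjoint sets of variables, so their substitutions can be glued.
  -- The conjunct `ρ x w` is carried along so that the value chosen for x can later be compared with
  -- what ρ admits.
  realise  : ∀ {s ρ} (p : Pat s) v → Basic p → PosLinear p → Sat ρ p v →
             ∃[ θ ] Sat (λ x w → exact θ x w × ρ x w) p v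
  realise* : ∀ {n ρ} (ps : Vec (Pat val) n) vs → Basic* ps → PosLinear* ps → Sat* ρ ps vs →
             ∃[ θ ] Sat* (λ x w → exact θ x w × ρ x w) ps vs
  realise (var x) v _ _ m = (λ _ → gr v) , refl , m
  realise (node f ps) v b l (vs , eq , m) = let θ , m′ = realise* ps vs b l m in θ , vs , eq , m′
  realise (var x at p) v b (l , d) (k , m) =
    let θ , m′ = realise p v b l m
        τ = λ _ → gr v
    in choose (_≟ x) τ θ , (choose-∈ (_≟ x) τ θ refl , k) ,
       Sat-mono p (λ { y j w (eq , r) →
         trans (choose-∉ (_≟ x) τ θ λ { refl → d y (here refl , j) }) eq , r }) v m′
  -- Nothing has to be bound here, and a ground default need not exist, since there may be no values
  -- at all.
  realise* [] [] _ _ _ = var , tt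
  realise* (p ∷ ps) (v ∷ vs) (b , bs) (l , ls , d) (m , ms) =
    let θ , m′ = realise p v b l m
        τ , ms′ = realise* ps vs bs ls ms
    in choose (PosV? p) θ τ ,
       Sat-mono p (λ { y j w (eq , r) → trans (choose-∈ (PosV? p) θ τ j) eq , r }) v m′ ,
       Sat-mono* ps (λ { y j w (eq , r) →
         trans (choose-∉ (PosV? p) θ τ λ i → d y (i , j)) eq , r }) vs ms′

  -- Applied to `exact θ`, this shows that θ is ground on all matchable variables.
  bound  : ∀ {s ρ x} (p : Pat s) v → Basic p → Sat ρ p v → MV p x → ∃[ w ] ρ x w
  bound* : ∀ {n ρ x} (ps : Vec (Pat val) n) vs → Basic* ps → Sat* ρ ps vs → MV* ps x → ∃[ w ] ρ x w
  bound (var x)      v b m            refl = v , m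
  bound (node f ps)  v b (vs , _ , m) j    = bound* ps vs b m j
  bound (var x at p) v b (k , m) (inj₁ (here refl)) = v , k
  bound (var x at p) v b (k , m) (inj₂ j)  = bound p v b m j
  bound* (p ∷ ps) (v ∷ vs) (b , bs) (m , ms) (inj₁ j) = bound p v b m j
  bound* (p ∷ ps) (v ∷ vs) (b , bs) (m , ms) (inj₂ j) = bound* ps vs bs ms j

  basic-pat  : ∀ t → Basic (pat t)
  basic-pat* : ∀ {n} (ts : Vec (T⟨C⟩ Var) n) → Basic* (pat* ts)
  basic-pat (var x)    = tt
  basic-pat (app c ts) = basic-pat* ts
  basic-pat* []       = tt
  basic-pat* (t ∷ ts) = basic-pat t , basic-pat* ts

  PosV-pat  : ∀ t → (_∈ vars t) ⊆′ PosV (pat t)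
  PosV-pat* : ∀ {n} (ts : Vec (T⟨C⟩ Var) n) → (_∈ vars* ts) ⊆′ PosV* (pat* ts)
  PosV-pat (var x)    _ (here refl) = refl
  PosV-pat (app c ts) x j           = PosV-pat* ts x j
  PosV-pat* (t ∷ ts)  x j           = Sum.map (PosV-pat t x) (PosV-pat* ts x) (∈-++⁻ (vars t) j)

  PosV-pat⁻  : ∀ t → PosV (pat t) ⊆′ (_∈ vars t)
  PosV-pat⁻* : ∀ {n} (ts : Vec (T⟨C⟩ Var) n) → PosV* (pat* ts) ⊆′ (_∈ vars* ts)
  PosV-pat⁻ (var x)    _ refl     = here refl
  PosV-pat⁻ (app c ts) x j        = PosV-pat⁻* ts x j
  PosV-pat⁻* (t ∷ ts)  x (inj₁ j) = ∈-++⁺ˡ (PosV-pat⁻ t x j)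
  PosV-pat⁻* (t ∷ ts)  x (inj₂ j) = ∈-++⁺ʳ (vars t) (PosV-pat⁻* ts x j)

  exact-pat  : ∀ {θ} t v → Sat (exact θ) (pat t) v → sub θ t ≡ gr v
  exact-pat* : ∀ {n θ} (ts : Vec (T⟨C⟩ Var) n) vs →
               Sat* (exact θ) (pat* ts) vs → sub* θ ts ≡ sub* (λ ()) vs
  exact-pat (var x)    v m               = m
  exact-pat (app c ts) v (vs , refl , m) = cong (app c) (exact-pat* ts vs m)
  exact-pat* []       []       _        = refl
  exact-pat* (t ∷ ts) (v ∷ vs) (m , ms) = cong₂ _∷_ (exact-pat t v m) (exact-pat* ts vs ms)

-- Renaming variables

module Correctness (S : Signature) (φ : Signature.Defined S) where
  open Rules S φ
  open Semantics S
  open Rewriting S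
  open NormalForms S

  -- A renaming sends variables to variables, which every value matches, so `⟦subP⟧` applies with
  -- its side condition trivial.
  ⟦variant⟧ : ∀ {s} (p : Pat s) {p′} → VarAliases p → Variant p p′ → ⟦ p′ ⟧ ≐′ ⟦ p ⟧
  ⟦variant⟧ p a (α , _ , refl) =
    let to  , from  = ⟦subP⟧ (var ∘ α) p a λ _ _ _ → tt
        to′ , from′ = ⟦⟧≐Sat p a
    in (λ v → from′ v ∘ to v) , (λ v → from v ∘ to′ v)

  variant-varAliases : ∀ {s} (p : Pat s) {p′} → VarAliases p → Variant p p′ → VarAliases p′
  variant-varAliases p a (α , _ , refl) = go p a
    where
    go  : ∀ {s} (p : Pat s) → VarAliases p → VarAliases (subP (var ∘ α) p)
    go* : ∀ {n} (ps : Vec (Pat val) n) → VarAliases* ps → VarAliases* (subP* (var ∘ α) ps)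
    go (var x)     _                = tt
    go (node f ps) a                = go* ps a
    go (p ⊕ q)     (a , b)          = go p a , go q b
    go (p ∖ q)     (a , b)          = go p a , go q b
    go bot         _                = tt
    go (q at p)    ((x , refl) , a) = (α x , refl) , go p a
    go* []         _                = tt
    go* (p ∷ ps)   (a , as)         = go p a , go* ps as

  -- Removing one alias

  module _ {x : Var} {q : T⟨C⟩ Var} where

    unalias-basic : ∀ {s} {p p′ : Pat s} → Cong (Unalias x q) p p′ → Basic p → Basic p′
    unalias-basic (root (unalias _)) b = b
    unalias-basic (inNode {ps = ps} i r) b = go ps i r b
      where
      go : ∀ {n p′} (ps : Vec (Pat val) n) i → Cong (Unalias x q) (Vec.lookup ps i) p′ →
           Basic* ps → Basic* (ps [ i ]≔ p′)
      go (p ∷ ps) zero    r (b , bs) = unalias-basic r b , bs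
      go (p ∷ ps) (suc i) r (b , bs) = b , go ps i r bs
    unalias-basic (inAt {q = var _} r) b = unalias-basic r b

    unalias-occurs : ∀ {s} {p p′ : Pat s} → Cong (Unalias x q) p p′ → Basic p → PosV p x
    unalias-occurs (root (unalias _)) b = inj₁ (here refl)
    unalias-occurs (inNode {ps = ps} i r) b =
      PosV*-lookup ps i x (unalias-occurs r (basic*-lookup ps i b))
    unalias-occurs (inAt {q = var _} r) b = inj₂ (unalias-occurs r b)

    -- In a linear pattern x occurs at the alias only. Once the alias is gone, x can be rebound
    -- without disturbing the match of `p′`.
    unalias-fresh : ∀ {s} {p p′ : Pat s} → Cong (Unalias x q) p p′ →
                    Basic p → PosLinear p → ¬ PosV p′ x
    unalias-fresh (root (unalias refl)) _ (_ , d) j = d x (here refl , j)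
    unalias-fresh (inNode {ps = ps} i r) b l = go ps i r b l
      where
      go : ∀ {n p′} (ps : Vec (Pat val) n) i → Cong (Unalias x q) (Vec.lookup ps i) p′ →
           Basic* ps → PosLinear* ps → ¬ PosV* (ps [ i ]≔ p′) x
      go (p ∷ ps) zero    r (b , _)  (l , _ , _)  (inj₁ j) = unalias-fresh r b l j
      go (p ∷ ps) zero    r (b , _)  (_ , _ , d)  (inj₂ j) = d x (unalias-occurs r b , j)
      go (p ∷ ps) (suc i) r (_ , bs) (_ , _ , d)  (inj₁ j) =
        d x (j , PosV*-lookup ps i x (unalias-occurs r (basic*-lookup ps i bs)))
      go (p ∷ ps) (suc i) r (_ , bs) (_ , ls , _) (inj₂ j) = go ps i r bs ls j
    unalias-fresh (inAt {q = var _} r) b (_ , d) (inj₁ (here refl)) =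
      d x (here refl , unalias-occurs r b)
    unalias-fresh (inAt {q = var _} r) b (l , _) (inj₂ j) = unalias-fresh r b l j

    unalias-vars : ∀ {s} {p p′ : Pat s} → Cong (Unalias x q) p p′ → Basic p → (_∈ vars q) ⊆′ PosV p′
    unalias-vars (root (unalias refl)) b y j = PosV-pat q y j
    unalias-vars (inNode {ps = ps} i r) b y j = go ps i r b
      where
      go : ∀ {n p′} (ps : Vec (Pat val) n) i → Cong (Unalias x q) (Vec.lookup ps i) p′ →
           Basic* ps → PosV* (ps [ i ]≔ p′) y
      go (p ∷ ps) zero    r (b , _)  = inj₁ (unalias-vars r b y j)
      go (p ∷ ps) (suc i) r (_ , bs) = inj₂ (go ps i r bs)
    unalias-vars (inAt {q = var _} r) b y j = inj₂ (unalias-vars r b y j)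

    unalias-exact : ∀ {s θ} {p p′ : Pat s} v → Cong (Unalias x q) p p′ → Basic p →
                    Sat (exact θ) p v → θ x ≡ sub θ q
    unalias-exact v (root (unalias refl)) b (k , m) = trans k (sym (exact-pat q v m))
    unalias-exact v (inNode {ps = ps} i r) b (vs , _ , m) =
      unalias-exact _ r (basic*-lookup ps i b) (Sat*-lookup ps vs i m)
    unalias-exact v (inAt {q = var _} r) b (_ , m) = unalias-exact v r b m

    unalias-MV : ∀ {s} {p p′ : Pat s} → Unalias x q p p′ → MV p ⊆′ ｛ x ｝ ∪ MV p′
    unalias-MV (unalias refl) _ (inj₁ (here refl)) = inj₁ refl
    unalias-MV (unalias refl) _ (inj₂ j)           = inj₂ j

    unalias-PosV : ∀ {s} {p p′ : Pat s} → Unalias x q p p′ → PosV p′ ⊆′ PosV p ∪ ∁ U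
    unalias-PosV (unalias refl) _ j = inj₁ (inj₂ j)

    unalias-posLinear : ∀ {s} {p p′ : Pat s} → Unalias x q p p′ →
                        PosV p ⊆′ U → PosLinear p → PosLinear p′
    unalias-posLinear (unalias refl) _ (l , _) = l

    -- The condition on ρ says that the alias adds nothing to q. It is trivial for `free`, and
    -- `exact θ` fulfils it as soon as θ x equals θ(q).
    unalias-Sat : ∀ {s} {p p′ : Pat s} → Unalias x q p p′ →
                  ∀ ρ → (∀ w → Sat ρ (pat q) w → ρ x w) → Sat ρ p ≐′ Sat ρ p′
    unalias-Sat (unalias refl) ρ ok = (λ _ → proj₂) , (λ v m → ok v m , m)

  -- Summands of normal forms

  Sat-summands : ∀ {s ρ} (p : Pat s) v → Sat ρ p v → Any (λ q → Sat ρ q v) (summands p)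
  Sat-summands (p ⊕ q)     v (inj₁ m) = Any.++⁺ˡ (Sat-summands p v m)
  Sat-summands (p ⊕ q)     v (inj₂ m) = Any.++⁺ʳ (summands p) (Sat-summands q v m)
  Sat-summands (var x)     v m        = here m
  Sat-summands (node f ps) v m        = here m
  Sat-summands (p ∖ q)     v m        = here m
  Sat-summands (q at p)    v m        = here m

  Sat-summands⁻ : ∀ {s ρ} (p : Pat s) v → Any (λ q → Sat ρ q v) (summands p) → Sat ρ p v
  Sat-summands⁻ (p ⊕ q)     v m        =
    Sum.map (Sat-summands⁻ p v) (Sat-summands⁻ q v) (Any.++⁻ (summands p) m)
  Sat-summands⁻ (var x)     v (here m) = m
  Sat-summands⁻ (node f ps) v (here m) = m
  Sat-summands⁻ (p ∖ q)     v (here m) = m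
  Sat-summands⁻ (q at p)    v (here m) = m

  all-summands : ∀ {s} (P : Pred (Pat s) 0ℓ) → (∀ p q → P (p ⊕ q) → P p × P q) →
                 ∀ p → P p → All P (summands p)
  all-summands P halves (p ⊕ q)     x =
    let y , z = halves p q x in All.++⁺ (all-summands P halves p y) (all-summands P halves q z)
  all-summands P halves bot         x = []
  all-summands P halves (var _)     x = x ∷ []
  all-summands P halves (node f ps) x = x ∷ []
  all-summands P halves (p ∖ q)     x = x ∷ []
  all-summands P halves (q at p)    x = x ∷ []

  basic-summands : ∀ {s} {q : Pat s} → VarAliases q → Normal q →
                   All (Avoids sum) (summands q) → All Basic (summands q)
  basic-summands {q = q} a n sumFree with normal-form q a n
  ... | _ , inj₁ refl = []
  ... | c , inj₂ pure = All.map
      (λ { {p} (s , (a , c) , b) → basic p a s c b })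
      (All.zip (sumFree , All.zip (All.zip
        ( all-summands VarAliases (λ _ _ → id) q a
        , all-summands Additive (λ _ _ → proj₂) q c)
        , all-summands Pure (λ _ _ → proj₂) q pure)))

  -- Contractions by a single rule

  record Good (ρ : Rule) : Set where
    field
      isBasic   : Basic (lhs ρ)
      posLinear : PosLinear (lhs ρ)
      vars⊆     : ∀ x → x ∈ vars (rhs ρ) → MV (lhs ρ) x

  SatContracts : Pat (tup (arity-def φ)) → T⟨F⟩ Var → Args → GroundTerm → Set
  SatContracts p r v u = ∃[ σ ] Dom σ ≐ MV p × Sat (within σ) p v × ground u ≡ inst σ r

  -- No domain is prescribed: alias removal changes `MV`, and θ may be arbitrary on variables that
  -- do not occur in the pattern.
  ExactContracts : Rule → Args → GroundTerm → Set
  ExactContracts (p ⟶ r) v u = ∃[ θ ] Sat (exact θ) p v × ground u ≡ inst θ r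

  outside-dom : ∀ {s σ x} (p : Pat s) → Dom σ ≐ MV p → ¬ MV p x → σ x ≡ var x
  outside-dom {σ = σ} {x} p (⊆ , _) x∉ with var-or-not (σ x) x
  ... | yes eq = eq
  ... | no neq = contradiction (⊆ neq) x∉

  outside-free : ∀ {s σ x} (p : Pat s) → Dom σ ≐ MV p → ¬ MV p x → ∀ v → within σ x v
  outside-free p dom x∉ v = subst (λ t → ⟦ t ⟧ᵗ v) (sym (outside-dom p dom x∉)) tt

  -- A negative variable is not matchable, hence outside the domain of σ; so σ fixes it and every
  -- value matches its image.
  contracts≐sat : ∀ p r → VarAliases p → MV p ⊥′ NegV p → ∀ v →
                  Contracts (p ⟶ r) v ≐′ SatContracts p r v
  contracts≐sat p r a disj v =
    (λ { u (σ , dom , m , eq) → σ , dom , proj₁ (sem σ dom) v m , eq }) ,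
    (λ { u (σ , dom , m , eq) → σ , dom , proj₂ (sem σ dom) v m , eq })
    where
    sem : ∀ σ → Dom σ ≐ MV p → ⟦ subP σ p ⟧ ≐′ Sat (within σ) p
    sem σ dom = ⟦subP⟧ σ p a λ x i → outside-free p dom λ j → disj x (j , i)

  sat⇒exact : ∀ {p r σ} v u → Good (p ⟶ r) → Sat (within σ) p v → ground u ≡ inst σ r →
              ExactContracts (p ⟶ r) v u
  sat⇒exact {p} {r} {σ} v u good m eq =
    let θ , m′ = realise p v isBasic posLinear m in
    θ , Sat-mono p (λ _ _ _ → proj₁) v m′ , trans eq (inst-cong r λ x x∈ →
      let w  , θx , wx = bound p v isBasic m′ (vars⊆ x x∈)
          w′ , σx      = ground-inst⁻ u r eq x∈
      -- A ground term is matched only by the value it denotes. Since `within σ` admits w at x, the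
      -- value denoted by σ x is w, as for θ x.
      in trans σx (trans (cong gr (sym (⟦gr⟧⁻ w′ (subst (λ t → ⟦ t ⟧ᵗ w) σx wx)))) (sym θx)))
    where open Good good

  -- Here q is the left-hand side before rewriting, which may have fewer
  -- matchable variables than p.
  exact⇒sat : ∀ {s} (q : Pat s) p r v u → Basic p → MV q ⊆′ MV p →
              (∀ x → x ∈ vars r → MV q x) → ExactContracts (p ⟶ r) v u →
              ∃[ σ ] Dom σ ≐ MV q × Sat (within σ) p v × ground u ≡ inst σ r
  exact⇒sat q p r v u b q⊆p r⊆q (θ , m , eq) =
    σ , (dom⊆ , ⊆dom) , Sat-mono p within-σ v m ,
    trans eq (inst-cong r λ x x∈ → sym (choose-∈ (MV? q) θ var (r⊆q x x∈)))
    where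
    σ : Subst
    σ = choose (MV? q) θ var
    dom⊆ : Dom σ ⊆ MV q
    dom⊆ {x} σx with MV? q x
    ... | yes x∈ = x∈
    ... | no x∉  = contradiction refl σx
    ⊆dom : MV q ⊆ Dom σ
    ⊆dom {x} x∈ σx =
      -- An exact domain requires that σ move every matchable variable of q; the match makes θ x
      -- ground, hence different from `var x`.
      let w , θx = bound p v b m (q⊆p x x∈)
      in gr≢var {w} (trans (sym θx) (trans (sym (choose-∈ (MV? q) θ var x∈)) σx))
    within-σ : ∀ x → PosV p x → exact θ x ⊆′ within σ x
    within-σ x _ w θx with MV? q x
    ... | yes _ = subst (λ t → ⟦ t ⟧ᵗ w) (sym θx) (⟦gr⟧ w)
    ... | no _  = tt

  module _ {ρ} (good : Good ρ) where
    open Good good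

    good-varAliases : VarAliases (lhs ρ)
    good-varAliases = basic⇒varAliases (lhs ρ) isBasic

    private
      sat = contracts≐sat (lhs ρ) (rhs ρ) good-varAliases λ x (_ , j) → basic⇒¬NegV (lhs ρ) isBasic x j

    contracts≐exact : ∀ v → Contracts ρ v ≐′ ExactContracts ρ v
    contracts≐exact v =
      (λ u c → let σ , _ , m , eq = proj₁ (sat v) u c in sat⇒exact v u good m eq) ,
      (λ u c → proj₂ (sat v) u (exact⇒sat (lhs ρ) (lhs ρ) (rhs ρ) v u isBasic (λ _ → id) vars⊆ c))

    -- In a list a matching rule blocks all later ones, so completeness requires that it has a
    -- contractum. It has one because the variables of the right-hand side are matchable and thus
    -- bound to values.
    matches⇒contracts : ∀ v → ⟦ lhs ρ ⟧ v → ∃[ u ] Contracts ρ v u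
    matches⇒contracts v m =
      let θ , m′ = realise (lhs ρ) v isBasic posLinear (proj₁ (⟦⟧≐Sat (lhs ρ) good-varAliases) v m)
          u , eq = ground-inst⁺ (rhs ρ) λ x x∈ →
            let w , θx , _ = bound (lhs ρ) v isBasic m′ (vars⊆ x x∈) in w , θx
      in u , proj₂ (contracts≐exact v) u (θ , Sat-mono (lhs ρ) (λ _ _ _ → proj₁) v m′ , eq)

    matches? : ∀ v → Dec (⟦ lhs ρ ⟧ v)
    matches? v = let to , from = ⟦⟧≐Sat (lhs ρ) good-varAliases in
      map′ (from v) (to v) (Sat-free? (lhs ρ) v)

  -- Matching is compared separately from contracting because it decides whether later rules of a
  -- list may act.
  Equivalent : Rule → Rule → Set
  Equivalent ρ ρ′ = ⟦ lhs ρ ⟧ ≐′ ⟦ lhs ρ′ ⟧ × (∀ v → Contracts ρ v ≐′ Contracts ρ′ v)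

  module _ {x q p p′ r} (c : Cong (Unalias x q) p p′) (good : Good (p ⟶ r)) where
    open Good good

    unalias-good : Good (p′ ⟶ inst (x ↦ q) r)
    unalias-good = record
      { isBasic   = basic′
      ; posLinear = cong-posLinear U unalias-PosV unalias-posLinear c (λ _ _ → tt) posLinear
      ; vars⊆     = vars⊆′
      }
      where
      basic′ : Basic p′
      basic′ = unalias-basic c isBasic
      vars⊆′ : ∀ y → y ∈ vars (inst (x ↦ q) r) → MV p′ y
      vars⊆′ y y∈ with vars-sub⁻ r y∈
      ... | z , z∈ , y∈z with z ≟ x
      ...   | yes refl = basic⇒PosV⊆MV p′ basic′ y (unalias-vars c isBasic y
                (vars-⌈⌉⁻ q (subst (λ t → y ∈ vars ⌈ t ⌉) (choose-∈ (_≟ x) (λ _ → q) var refl) y∈z)))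
      ...   | no z≢x
        with subst (λ t → y ∈ vars ⌈ t ⌉) (choose-∉ (_≟ x) (λ _ → q) var z≢x) y∈z
           | cong-MV ｛ x ｝ unalias-MV c z (vars⊆ z z∈)
      ...     | here refl | inj₁ refl = contradiction refl z≢x
      ...     | here refl | inj₂ j    = j

    private
      Sat≐ = cong-Sat (λ ρ → ∀ w → Sat ρ (pat q) w → ρ x w) (λ _ _ → tt) unalias-Sat c

    unalias-contracts : ∀ v → ExactContracts (p ⟶ r) v ≐′ ExactContracts (p′ ⟶ inst (x ↦ q) r) v
    unalias-contracts v = to , from
      where
      to : ExactContracts (p ⟶ r) v ⊆′ ExactContracts (p′ ⟶ inst (x ↦ q) r) v
      to u (θ , m , eq) = θ , proj₁ (Sat≐ (exact θ) λ w n → trans θx (exact-pat q w n)) v m ,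
        trans eq (sym (trans (inst-inst θ (x ↦ q) r) (inst-cong r pointwise)))
        where
        θx : θ x ≡ sub θ q
        θx = unalias-exact v c isBasic m
        pointwise : ∀ y → y ∈ vars r → sub θ ((x ↦ q) y) ≡ θ y
        pointwise y _ with y ≟ x
        ... | yes refl = trans (cong (sub θ) (choose-∈ (_≟ x) (λ _ → q) var refl)) (sym θx)
        ... | no y≢x   = cong (sub θ) (choose-∉ (_≟ x) (λ _ → q) var y≢x)
      from : ExactContracts (p′ ⟶ inst (x ↦ q) r) v ⊆′ ExactContracts (p ⟶ r) v
      from u (θ , m , eq) =
        τ , proj₂ (Sat≐ (exact τ) τx) v (Sat-mono p′ (λ y j w θy → trans (τ-other y j) θy) v m) ,
        trans eq (inst-inst θ (x ↦ q) r)
        where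
        τ : Subst
        -- Since x does not occur in `p′`, θ x is arbitrary; τ rebinds x to θ(q), as the alias
        -- demands, and agrees with θ elsewhere.
        τ = sub θ ∘ (x ↦ q)
        τ-other : ∀ y → PosV p′ y → τ y ≡ θ y
        τ-other y j = cong (sub θ) (choose-∉ (_≟ x) (λ _ → q) var
          λ { refl → unalias-fresh c isBasic posLinear j })
        τx : ∀ w → Sat (exact τ) (pat q) w → τ x ≡ gr w
        τx w n = trans (cong (sub θ) (choose-∈ (_≟ x) (λ _ → q) var refl))
          (exact-pat q w (Sat-mono (pat q)
            (λ y j w τy → trans (sym (τ-other y (unalias-vars c isBasic y (PosV-pat⁻ q y j)))) τy) w n))

    unalias-equivalent : Equivalent (p ⟶ r) (p′ ⟶ inst (x ↦ q) r)
    unalias-equivalent =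
      ≐′-trans (⟦⟧≐Sat p (good-varAliases good))
        (≐′-trans (Sat≐ free λ _ _ → tt) (≐′-sym (⟦⟧≐Sat p′ (good-varAliases unalias-good)))) ,
      λ v → ≐′-trans (contracts≐exact good v)
              (≐′-trans (unalias-contracts v) (≐′-sym (contracts≐exact unalias-good v)))

  𝔗at-rule-equivalent : ∀ {ρ ρ′} → 𝔗at-rule ρ ρ′ → Good ρ → Equivalent ρ ρ′
  𝔗at-rule-equivalent (stop _) good = ≐′-refl , λ _ → ≐′-refl
  𝔗at-rule-equivalent (step c rs) good =
    let m  , cs  = unalias-equivalent c good
        m′ , cs′ = 𝔗at-rule-equivalent rs (unalias-good c good)
    in ≐′-trans m m′ , λ v → ≐′-trans (cs v) (cs′ v)

  𝔗at-equivalent : ∀ {L M} → 𝔗at L M → All Good L → Pointwise Equivalent L M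
  𝔗at-equivalent []       []       = []
  𝔗at-equivalent (r ∷ rs) (g ∷ gs) = 𝔗at-rule-equivalent r g ∷ 𝔗at-equivalent rs gs

  -- The rules split off from one pattern

  AnyMatches : List Rule → Pred Args 0ℓ
  AnyMatches L v = Any (λ ρ → ⟦ lhs ρ ⟧ v) L

  AnyContracts : List Rule → Args → GroundTerm → Set
  AnyContracts L v u = Any (λ ρ → Contracts ρ v u) L

  record IsSplit (d : Pat (tup (arity-def φ))) (r : T⟨F⟩ Var) (Q : List Rule) : Set where
    field
      good      : All Good Q
      matches   : Sat free d ≐′ AnyMatches Q
      contracts : ∀ v → SatContracts d r v ≐′ AnyContracts Q v

  isSplit : ∀ {d r Q} → Split d r Q → VarAliases d → PosLinear d →
            (∀ x → x ∈ vars r → MV d x) → MV d ⊆′ PosV d → IsSplit d r Q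
  isSplit {d} {r} (split {q} d↓q sumFree) a l r⊆ MV⊆PosVd = record
    { good      = All.map⁺ (All.map proj₁ summands-good)
    ; matches   = matches-to , matches-from
    ; contracts = λ v → contracts-to v , contracts-from v
    }
    where
    open Reduct (reduct d↓q a l (PosV⊆varsP d))

    Q : List Rule
    Q = map (_⟶ r) (summands q)

    summands-good : All (λ p → Good (p ⟶ r) × MV d ⊆′ MV p) (summands q)
    summands-good = All.map
      (λ { (b , l , m) → record { isBasic = b ; posLinear = l ; vars⊆ = λ x → m x ∘ r⊆ x } , m })
      (All.zip (basic-summands varAliases normal sumFree ,
                All.zip (all-summands PosLinear (λ _ _ → id) q posLinear ,
                         all-summands (λ p → MV d ⊆′ MV p)
                           (λ _ _ m → (λ x → proj₁ ∘ m x) , (λ x → proj₂ ∘ m x)) q MV⊆)))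

    -- Variables absent from d are not in `MV d`, hence outside the domain of σ. This makes
    -- `within σ` admissible for the whole reduction of d.
    fresh-free : ∀ {σ} → Dom σ ≐ MV d → ∀ z → z ∉ varsP d → ∀ v → within σ z v
    fresh-free dom z z∉ = outside-free d dom λ j → z∉ (PosV⊆varsP d z (MV⊆PosVd z j))

    matches-to : Sat free d ⊆′ AnyMatches Q
    matches-to v m =
      let p , p∈ , k = find (Sat-summands q v (proj₁ (Sat≐ free λ _ _ _ → tt) v m))
          good , _   = All.lookup summands-good p∈
      in Any.map⁺ (lose p∈ (proj₂ (⟦⟧≐Sat p (good-varAliases good)) v k))

    matches-from : AnyMatches Q ⊆′ Sat free d
    matches-from v m =
      let p , p∈ , k = find (Any.map⁻ m)
          good , _   = All.lookup summands-good p∈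
      in proj₂ (Sat≐ free λ _ _ _ → tt) v
           (Sat-summands⁻ q v (lose p∈ (proj₁ (⟦⟧≐Sat p (good-varAliases good)) v k)))

    contracts-to : ∀ v → SatContracts d r v ⊆′ AnyContracts Q v
    contracts-to v u (σ , dom , m , eq) =
      let p , p∈ , k = find (Sat-summands q v (proj₁ (Sat≐ (within σ) (fresh-free dom)) v m))
          good , _   = All.lookup summands-good p∈
      in Any.map⁺ (lose p∈ (proj₂ (contracts≐exact good v) u (sat⇒exact v u good k eq)))

    contracts-from : ∀ v → AnyContracts Q v ⊆′ SatContracts d r v
    contracts-from v u c =
      let p , p∈ , k       = find (Any.map⁻ c)
          good , d⊆p       = All.lookup summands-good p∈
          σ , dom , m , eq = exact⇒sat d p r v u (Good.isBasic good) d⊆p r⊆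
                               (proj₁ (contracts≐exact good v) u k)
      in σ , dom , proj₂ (Sat≐ (within σ) (fresh-free dom)) v (Sat-summands⁻ q v (lose p∈ m)) , eq

  -- Ordered lists of rules

  FirstContracts : List Rule → Args → GroundTerm → Set
  FirstContracts []      v u = ⊥
  FirstContracts (ρ ∷ L) v u = Contracts ρ v u ⊎ ¬ ⟦ lhs ρ ⟧ v × FirstContracts L v u

  listContracts≐first : ∀ L v → ListContracts L v ≐′ FirstContracts L v
  listContracts≐first L v = to L , from L
    where
    to : ∀ L → ListContracts L v ⊆′ FirstContracts L v
    to (ρ ∷ L) u (zero  , _   , c) = inj₁ c
    to (ρ ∷ L) u (suc i , pre , c) =
      inj₂ (pre zero (s≤s z≤n) , to L u (i , (λ j j<i → pre (suc j) (s≤s j<i)) , c))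
    from : ∀ L → FirstContracts L v ⊆′ ListContracts L v
    from (ρ ∷ L) u (inj₁ c) = zero , (λ _ ()) , c
    from (ρ ∷ L) u (inj₂ (¬m , f)) =
      let i , pre , c = from L u f in
      suc i , (λ { zero _ → ¬m ; (suc j) (s≤s j<i) → pre j j<i }) , c

  first-equivalent : ∀ {L M} → Pointwise Equivalent L M →
                     ∀ v → FirstContracts L v ≐′ FirstContracts M v
  first-equivalent [] v = ≐′-refl
  first-equivalent ((m , c) ∷ es) v =
    let f = first-equivalent es v in
    (λ u → Sum.map (proj₁ (c v) u) λ (¬m , k) → ¬m ∘ proj₂ m v , proj₁ f u k) ,
    (λ u → Sum.map (proj₂ (c v) u) λ (¬m , k) → ¬m ∘ proj₁ m v , proj₂ f u k)

  any-equivalent : ∀ {L M} → Pointwise Equivalent L M → ∀ v → AnyContracts L v ≐′ AnyContracts M v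
  any-equivalent [] v = (λ _ ()) , (λ _ ())
  any-equivalent ((_ , c) ∷ es) v =
    let f = any-equivalent es v in
    (λ { u (here k) → here (proj₁ (c v) u k) ; u (there k) → there (proj₁ f u k) }) ,
    (λ { u (here k) → here (proj₂ (c v) u k) ; u (there k) → there (proj₂ f u k) })

  first-++⁻ : ∀ Q {M v u} → FirstContracts (Q ++ M) v u →
              AnyContracts Q v u ⊎ ¬ AnyMatches Q v × FirstContracts M v u
  first-++⁻ []      f = inj₂ ((λ ()) , f)
  first-++⁻ (ρ ∷ Q) (inj₁ c) = inj₁ (here c)
  first-++⁻ (ρ ∷ Q) (inj₂ (¬m , f)) with first-++⁻ Q f
  ... | inj₁ c        = inj₁ (there c)
  ... | inj₂ (¬n , g) = inj₂ ((λ { (here m) → ¬m m ; (there n) → ¬n n }) , g)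

  first-++⁺ˡ : ∀ Q {M v u} → FirstContracts Q v u → FirstContracts (Q ++ M) v u
  first-++⁺ˡ (ρ ∷ Q) = Sum.map₂ λ (¬m , f) → ¬m , first-++⁺ˡ Q f

  first-++⁺ʳ : ∀ Q {M v u} → ¬ AnyMatches Q v → FirstContracts M v u → FirstContracts (Q ++ M) v u
  first-++⁺ʳ []      ¬m f = f
  first-++⁺ʳ (ρ ∷ Q) ¬m f = inj₂ (¬m ∘ here , first-++⁺ʳ Q (¬m ∘ there) f)

  -- Some member matches; deciding the rules in turn finds the first that does, and that one
  -- contracts.
  matches⇒first : ∀ {Q} → All Good Q → ∀ v → AnyMatches Q v → ∃[ u ] FirstContracts Q v u
  matches⇒first (good ∷ goods) v m with matches? good v
  ... | yes k = let u , c = matches⇒contracts good v k in u , inj₁ c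
  matches⇒first (good ∷ goods) v (here m)  | no ¬k = contradiction m ¬k
  matches⇒first (good ∷ goods) v (there m) | no ¬k =
    let u , f = matches⇒first goods v m in u , inj₂ (¬k , f)

  module _ {ρ} (ext : ExtendedRule ρ) where
    open ExtendedRule ext

    extended-contracts : ∀ v → Contracts ρ v ≐′ SatContracts (lhs ρ) (rhs ρ) v
    extended-contracts = contracts≐sat (lhs ρ) (rhs ρ) varAliases (linear⇒MV⊥NegV (lhs ρ) linear pure)

    extended-split : ∀ {Q} → Split (lhs ρ) (rhs ρ) Q → IsSplit (lhs ρ) (rhs ρ) Q
    extended-split s = isSplit s varAliases (linear⇒posLinear (lhs ρ) linear)
      (λ x x∈ → vars⊆ x∈) (MV⊆PosV (lhs ρ) pure)

  -- `complete` cannot keep u: the summand that gives u may come after another summand that matches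
  -- v and contracts it differently.
  record IsOrdered (L M : List Rule) : Set where
    field
      good     : All Good M
      sound    : ∀ v u → FirstContracts M v u → FirstContracts L v u
      complete : ∀ v u → FirstContracts L v u → ∃[ u′ ] FirstContracts M v u′

  isOrdered : ∀ {L M} → 𝔗∖ L M → All ExtendedRule L → IsOrdered L M
  isOrdered [] [] = record { good = [] ; sound = λ _ _ () ; complete = λ _ _ () }
  isOrdered (_∷_ {p} {r} {Q} {L} {M} s t) (ext ∷ exts) = record
    { good = All.++⁺ (good parts) (IsOrdered.good rest)
    ; sound = sound′
    ; complete = complete′
    }
    where
    open IsSplit
    parts = extended-split ext s
    rest = isOrdered t exts
    match = ≐′-trans (⟦⟧≐Sat p (ExtendedRule.varAliases ext)) (matches parts)
    sound′ : ∀ v u → FirstContracts (Q ++ M) v u → FirstContracts ((p ⟶ r) ∷ L) v u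
    sound′ v u f with first-++⁻ Q f
    ... | inj₁ c        = inj₁ (proj₂ (extended-contracts ext v) u (proj₂ (contracts parts v) u c))
    ... | inj₂ (¬m , g) = inj₂ (¬m ∘ proj₁ match v , IsOrdered.sound rest v u g)
    complete′ : ∀ v u → FirstContracts ((p ⟶ r) ∷ L) v u → ∃[ u′ ] FirstContracts (Q ++ M) v u′
    complete′ v u (inj₁ c@(σ , _)) =
      -- Forgetting σ leaves a plain match of p, hence of some split rule. The first split rule that
      -- matches supplies the new contractum.
      let _ , _ , m , _ = proj₁ (extended-contracts ext v) u c
          u′ , f = matches⇒first (good parts) v
            (proj₁ (matches parts) v (Sat-mono p (λ _ _ _ _ → tt) v m))
      in u′ , first-++⁺ˡ Q f
    complete′ v u (inj₂ (¬m , f)) =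
      let u′ , g = IsOrdered.complete rest v u f in u′ , first-++⁺ʳ Q (¬m ∘ proj₂ match v) g

  -- Subtracting the preceding patterns

  NoMatch : ∀ {s} → List (Pat s) → Pred (Val s) 0ℓ
  NoMatch ps v = All (λ p → ¬ ⟦ p ⟧ v) ps

  variants-varAliases : ∀ {s} {ps ps′ : List (Pat s)} → Pointwise Variant ps ps′ →
                        All VarAliases ps → All VarAliases ps′
  variants-varAliases []       []       = []
  variants-varAliases {ps = p ∷ _} (w ∷ ws) (a ∷ as) =
    variant-varAliases p a w ∷ variants-varAliases ws as

  variants-noMatch : ∀ {s} {ps ps′ : List (Pat s)} → Pointwise Variant ps ps′ →
                     All VarAliases ps → NoMatch ps ≐′ NoMatch ps′
  variants-noMatch [] [] = (λ { _ [] → [] }) , (λ { _ [] → [] })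
  variants-noMatch {ps = p ∷ _} (w ∷ ws) (a ∷ as) =
    let to , from   = ⟦variant⟧ p a w
        to* , from* = variants-noMatch ws as
    in (λ { v (¬m ∷ ¬ms) → ¬m ∘ to v ∷ to* v ¬ms }) ,
       (λ { v (¬m ∷ ¬ms) → ¬m ∘ from v ∷ from* v ¬ms })

  ⨁-noMatch : ∀ {s} {ps : List (Pat s)} → All VarAliases ps → (¬_ ∘ Sat free (⨁ ps)) ≐′ NoMatch ps
  ⨁-noMatch {ps = ps} as =
    (λ v ¬m → All.tabulate λ {p} p∈ m →
      ¬m (Sat-⨁⁺ ps (lose p∈ (proj₁ (⟦⟧≐Sat p (All.lookup as p∈)) v m)))) ,
    (λ v ¬ms m → let p , p∈ , k = find (Sat-⨁⁻ ps m) in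
      All.lookup ¬ms p∈ (proj₂ (⟦⟧≐Sat p (All.lookup as p∈)) v k))

  -- `MV` ignores what is subtracted, so p and d admit substitutions with the same domain. As
  -- subtracted patterns are matched under `free`, their effect is the same for every ρ.
  record IsMinus (p : Pat (tup (arity-def φ))) (ps : List (Pat (tup (arity-def φ))))
                 (d : Pat (tup (arity-def φ))) : Set₁ where
    field
      varAliases : VarAliases d
      posLinear  : PosLinear d
      MV≡        : MV d ≡ MV p
      matchable⊆     : MV d ⊆′ PosV d
      Sat≐       : ∀ ρ → Sat ρ d ≐′ Sat ρ p ∩ NoMatch ps

  isMinus : ∀ {p ps d} → Minus p ps d → VarAliases p → PosLinear p → MV p ⊆′ PosV p →
            All VarAliases ps → IsMinus p ps d
  isMinus nothing a l m [] = record
    { varAliases = a ; posLinear = l ; MV≡ = refl ; matchable⊆ = m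
    ; Sat≐ = λ ρ → (λ v k → k , []) , (λ v → proj₁) }
  isMinus (some {p₁' = p₁′} {ps' = ps′} ws _) a l m as = record
    { varAliases = a , varAliases-⨁ (p₁′ ∷ ps′) as′ ; posLinear = l ; MV≡ = refl ; matchable⊆ = m
    ; Sat≐ = λ ρ →
        (λ v (k , ¬n) → k , proj₂ (variants-noMatch ws as) v (proj₁ (⨁-noMatch as′) v ¬n)) ,
        (λ v (k , ¬n) → k , proj₂ (⨁-noMatch as′) v (proj₁ (variants-noMatch ws as) v ¬n))
    }
    where as′ = variants-varAliases ws as

  -- The failed matches of the preceding left-hand sides `ps` take over the role of the order in the
  -- list. Unlike in `IsOrdered` the contractum is kept, because every summand of a set may act.
  record IsUnordered (ps : List (Pat (tup (arity-def φ)))) (L M : List Rule) : Set where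
    field
      good      : All Good M
      contracts : ∀ v → AnyContracts M v ≐′ (λ u → NoMatch ps v × FirstContracts L v u)

  isUnordered : ∀ {ps L M} → 𝔗<-after ps L M → All VarAliases ps → All ExtendedRule L →
                IsUnordered ps L M
  isUnordered [] as [] = record { good = [] ; contracts = λ v → (λ _ ()) , (λ _ ()) }
  isUnordered {ps} (_∷_ {p = p} {d} {r} {Q} {L} {M} (minus , s) t) as (ext ∷ exts) = record
    { good      = All.++⁺ (IsSplit.good parts) (IsUnordered.good rest)
    ; contracts = λ v → to v , from v
    }
    where
    open ExtendedRule ext
    diff = isMinus minus varAliases (linear⇒posLinear p linear) (MV⊆PosV p pure) as
    parts = isSplit s (IsMinus.varAliases diff) (IsMinus.posLinear diff)
      (λ x x∈ → subst (λ P → P x) (sym (IsMinus.MV≡ diff)) (vars⊆ x∈)) (IsMinus.matchable⊆ diff)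
    rest = isUnordered t (All.∷ʳ⁺ as varAliases) exts
    to : ∀ v → AnyContracts (Q ++ M) v ⊆′ (λ u → NoMatch ps v × FirstContracts ((p ⟶ r) ∷ L) v u)
    to v u c with Any.++⁻ Q c
    ... | inj₁ k =
      let σ , dom , m , eq = proj₂ (IsSplit.contracts parts v) u k
          m′ , ¬ms = proj₁ (IsMinus.Sat≐ diff (within σ)) v m
      in ¬ms , inj₁ (proj₂ (extended-contracts ext v) u
           (σ , subst (Dom σ ≐_) (IsMinus.MV≡ diff) dom , m′ , eq))
    ... | inj₂ k =
      let ¬ms , f = proj₁ (IsUnordered.contracts rest v) u k
          -- The last of the patterns subtracted from the tail is p itself; its failure to match is
          -- what lets the tail of the list act.
          ¬ms′ , ¬m = All.∷ʳ⁻ ¬ms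
      in ¬ms′ , inj₂ (¬m , f)
    from : ∀ v → (λ u → NoMatch ps v × FirstContracts ((p ⟶ r) ∷ L) v u) ⊆′ AnyContracts (Q ++ M) v
    from v u (¬ms , inj₁ c) =
      let σ , dom , m , eq = proj₁ (extended-contracts ext v) u c in
      Any.++⁺ˡ (proj₁ (IsSplit.contracts parts v) u
        (σ , subst (Dom σ ≐_) (sym (IsMinus.MV≡ diff)) dom ,
         proj₂ (IsMinus.Sat≐ diff (within σ)) v (m , ¬ms) , eq))
    from v u (¬ms , inj₂ (¬m , f)) =
      Any.++⁺ʳ Q (proj₂ (IsUnordered.contracts rest v) u (All.∷ʳ⁺ ¬ms ¬m , f))

  -- From rules to reduction steps

  module _ {L} (exts : All ExtendedRule L) where

    ap-sound : ∀ {M} → 𝔗ap L M → ∀ v u → ListContracts M v u → ListContracts L v u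
    ap-sound {M} (L′ , t , a) v u c =
      proj₂ (listContracts≐first L v) u (sound v u
        (proj₂ (first-equivalent (𝔗at-equivalent a good) v) u (proj₁ (listContracts≐first M v) u c)))
      where open IsOrdered (isOrdered t exts)

    -- By soundness the contractum of the transformed list is one of L, hence u.
    ap-complete : ∀ {M} → 𝔗ap L M → Unambiguous L → ∀ v u → ListContracts L v u → ListContracts M v u
    ap-complete {M} ap@(L′ , t , a) unamb v u c =
      let u′ , f = complete v u (proj₁ (listContracts≐first L v) u c)
          c′     = proj₂ (listContracts≐first M v) u′
                     (proj₁ (first-equivalent (𝔗at-equivalent a good) v) u′ f)
      in subst (ListContracts M v) (unamb {v} {u′} {u} (ap-sound ap v u′ c′) c) c′
      where open IsOrdered (isOrdered t exts)

    unordered : ∀ {R} → 𝔗 L R → ∀ v → ListContracts L v ≐′ SetContracts (_∈ R) v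
    unordered (L′ , t , a) v =
      ≐′-trans (listContracts≐first L v)
        -- At the head of the list no pattern precedes, so `NoMatch` holds by the empty list.
        (≐′-trans ((λ u f → proj₂ (contracts v) u ([] , f)) , λ u c → proj₂ (proj₁ (contracts v) u c))
          (≐′-trans (any-equivalent (𝔗at-equivalent a good) v)
            ((λ u → find) , (λ u (ρ , ρ∈ , c) → lose ρ∈ c))))
      where open IsUnordered (isUnordered t [] exts)

  step-mono : ∀ {R R′ : Args → GroundTerm → Set} → (∀ v u → R v u → R′ v u) →
              ∀ {t t′} → Step R t t′ → Step R′ t t′
  step-mono R⊆ (ω , v , u , redex , c , eq) = ω , v , u , redex , R⊆ v u c , eq

corollary1 : (S : Signature) (φ : Signature.Defined S) → let open Rules S φ in
    (L : List Rule) → All ExtendedRule L → (t t' : GroundTerm) →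
    ((L' : List Rule) → 𝔗ap L L' →
    (Unambiguous L → t ⟶[ L ] t' → t ⟶[ L' ] t') ×
    (t ⟶[ L' ] t' → t ⟶[ L ] t')) ×
    ((R : List Rule) → 𝔗 L R →
    (t ⟶[ L ] t' ⇔ t ⟶⟨ _∈ R ⟩ t'))
corollary1 S φ L exts t t' =
  (λ L' ap → (λ unamb → step-mono (ap-complete exts ap unamb)) , step-mono (ap-sound exts ap)) ,
  (λ R tr → mk⇔ (step-mono λ v → proj₁ (unordered exts tr v))
                (step-mono λ v → proj₂ (unordered exts tr v)))
  where open Correctness S φ
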